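{- There is an adaptive distribution tester for the property of being the uniform distribution over $[n]$ (that is, for the property $\{U_n\}$, where $U_n(i)=1/n$ for all $i\in[n]$) whose conditional sample complexity is $\mathrm{poly}(\epsilon^{ -1},\log(\delta^{ -1}))$, independently of $n$. That is, there is a polynomial $p$ such that for all $\epsilon,\delta\in(0,1)$ and all $n$ the tester makes at most $p(\epsilon^{ -1},\log(\delta^{ -1}))$ conditional samples.
   Context: $[n]=\{1,\ldots,n\}$. A conditional sampling oracle for a distribution $\mu$ over $[n]$ takes a nonempty set $A\subseteq[n]$ and returns $j\in A$ with probability $\mu(j)/\mu(A)$ if $\mu(A)>0$, and a uniformly random member of $A$ if $\mu(A)=0$, independently of all previous samples. The variation distance is $d(\mu,\mu')=\frac12\sum_{i=1}^n|\mu(i)-\mu'(i)|$. A property $\mathcal P$ is a set of distributions over $[n]$; $\mu$ is $\epsilon$-far from $\mathcal P$ if $d(\mu,\mu')\ge\epsilon$ for every $\mu'\in\mathcal P$. An adaptive distribution tester for $\mathcal P$ with conditional sample complexity $t(\epsilon,\delta,n)$ is a randomized algorithm that receives $\epsilon,\delta>0$, $n\in\mathbb N$ and a conditional sampling oracle for an unknown distribution $\mu$ over $[n]$. In phase $i=1,\ldots,t(\epsilon,\delta,n)$ it generates a set $A_i\subseteq[n]$ based on the previously received samples $j_1,\ldots,j_{i-1}$ and its internal coin tosses, and receives a sample $j_i$ from the oracle on $A_i$. At the end it accepts or rejects based on $j_1,\ldots,j_t$ and its coin tosses. If $\mu\in\mathcal P$ it must accept with probability at least $1-\delta$; if $\mu$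 is $\epsilon$-far from $\mathcal P$ it must reject with probability at least $1-\delta$. $f=\mathrm{poly}(g_1,\ldots,g_k)$ means that there is a polynomial $p$ with $f\le p(g_1,\ldots,g_k)$ for all values of the arguments in their domains. -}

module Defs where

open import Algebra.Apartness.Structures using (IsHeytingField)
open import Algebra.Bundles using (CommutativeRing)
open import Algebra.Core using (Op₁; Op₂)
import Algebra.Properties.Semiring.Exp as Exp
import Algebra.Properties.Semiring.Mult as Mult
import Algebra.Properties.Semiring.Sum as Sum
open import Data.Bool.Base using (Bool; true; false; if_then_else_)
open import Data.Bool.Properties using (_≟_)
open import Data.Fin.Base using (Fin; toℕ)
open import Data.Fin.Subset using (Subset; Nonempty; _∈_; _∉_; ∣_∣)
open import Data.Fin.Subset.Properties using (_∈?_; x∈p⇒∣p-x∣<∣p∣)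
open import Data.Nat.Base as ℕ using (ℕ; zero; suc; NonZero; >-nonZero; _!)
open import Data.Nat.Properties as ℕ using (_!≢0)
open import Data.Product.Base using (_×_; _,_; proj₁; ∃-syntax)
open import Data.Sum.Base using (_⊎_; inj₂)
open import Level using () renaming (_⊔_ to _⊔ℓ_; suc to sucℓ)
open import Relation.Binary.Core using (Rel)
open import Relation.Binary.Lattice.Definitions using (Supremum)
open import Relation.Binary.Structures using (IsStrictPartialOrder)
open import Relation.Nullary.Decidable.Core using (does)
open import Relation.Nullary.Negation.Core using (¬_)
open import Relation.Unary using (Pred)

-- The real numbers, axiomatised as a Cauchy complete Archimedean ordered field.
-- Classically this determines ℝ up to isomorphism.  The axioms are phrased with
-- a strict order and an apartness so that they do not presuppose that the order
-- is decidable; a total order satisfying them is an instance.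
record RealNumbers c ℓ₁ ℓ₂ : Set (sucℓ (c ⊔ℓ ℓ₁ ⊔ℓ ℓ₂)) where
  infix  8 -_
  infixl 7 _*_
  infixl 6 _+_
  infixl 6 _⊔_
  infix  4 _≈_ _#_ _<_ _≤_
  field
    Carrier : Set c
    _≈_     : Rel Carrier ℓ₁
    _#_     : Rel Carrier ℓ₂
    _<_     : Rel Carrier ℓ₂
    _+_ _*_ : Op₂ Carrier
    -_      : Op₁ Carrier
    0# 1#   : Carrier
    _⊔_     : Op₂ Carrier

    isHeytingField       : IsHeytingField _≈_ _#_ _+_ _*_ -_ 0# 1#
    isStrictPartialOrder : IsStrictPartialOrder _≈_ _<_

  open IsHeytingField isHeytingField public
    using (isCommutativeRing; #⇒invertible; invertible⇒#; #-irrefl; #-sym; #-cotrans; tight)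
  open IsStrictPartialOrder isStrictPartialOrder public
    using (<-resp-≈; <-respˡ-≈; <-respʳ-≈)
    renaming (irrefl to <-irrefl; trans to <-trans; asym to <-asym)

  _≤_ : Rel Carrier ℓ₂
  x ≤ y = ¬ (y < x)

  field
    #⇒<⊎>       : ∀ {x y} → x # y → x < y ⊎ y < x
    <⊎>⇒#       : ∀ {x y} → x < y ⊎ y < x → x # y
    0<1         : 0# < 1#
    +-monoˡ-<   : ∀ z {x y} → x < y → x + z < y + z
    *-pos       : ∀ {x y} → 0# < x → 0# < y → 0# < x * y
    ⊔-supremum  : Supremum _≤_ _⊔_

  commutativeRing : CommutativeRing c ℓ₁
  commutativeRing = record { isCommutativeRing = isCommutativeRing }

  open CommutativeRing commutativeRing public
    using (semiring; setoid; +-identityˡ; _-_)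
  open Exp semiring public using (_^_)
  open Mult semiring public using () renaming (_×_ to _·_)
  open Sum semiring public using (sum-syntax)

  ∣_∣ᴿ : Op₁ Carrier
  ∣ x ∣ᴿ = x ⊔ - x

  fromℕ : ℕ → Carrier
  fromℕ n = n · 1#

  infix 4 _⟶_
  _⟶_ : (ℕ → Carrier) → Carrier → Set (c ⊔ℓ ℓ₂)
  f ⟶ x = ∀ e → 0# < e → ∃[ N ] (∀ m → N ℕ.≤ m → ∣ f m - x ∣ᴿ < e)

  Cauchy : (ℕ → Carrier) → Set (c ⊔ℓ ℓ₂)
  Cauchy f = ∀ e → 0# < e →
    ∃[ N ] (∀ m n → N ℕ.≤ m → N ℕ.≤ n → ∣ f m - f n ∣ᴿ < e)

  field
    archimedean : ∀ x → ∃[ n ] (x < fromℕ n)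
    complete    : ∀ f → Cauchy f → ∃[ x ] (f ⟶ x)

  recip : ∀ x → 0# < x → Carrier
  recip x 0<x = proj₁ (#⇒invertible (<⊎>⇒# {x} {0#} (inj₂ 0<x)))

  0<fromℕ-suc : ∀ n → 0# < fromℕ (suc n)
  0<fromℕ-suc zero    = <-respʳ-≈ (CommutativeRing.sym commutativeRing
                          (CommutativeRing.+-identityʳ commutativeRing 1#)) 0<1
  0<fromℕ-suc (suc n) = <-trans (0<fromℕ-suc n)
    (<-respˡ-≈ (+-identityˡ _) (+-monoˡ-< (fromℕ (suc n)) 0<1))

  1/ℕ_ : (n : ℕ) .{{_ : NonZero n}} → Carrier
  1/ℕ (suc n) = recip (fromℕ (suc n)) (0<fromℕ-suc n)

  expPartialSum : Carrier → ℕ → Carrier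
  expPartialSum x m =
    ∑[ k < m ] ((x ^ toℕ k) * (1/ℕ_ (toℕ k !) {{toℕ k !≢0}}))

  -- ℓ is the natural logarithm of x, i.e. x = ∑ₖ ℓᵏ / k!.
  IsLog : Carrier → Carrier → Set (c ⊔ℓ ℓ₂)
  IsLog x ℓ = expPartialSum ℓ ⟶ x

  record Polynomial₂ : Set c where
    field
      bound : ℕ
      coeff : Fin bound → Fin bound → Carrier

    eval : Carrier → Carrier → Carrier
    eval x y = ∑[ i < bound ] ∑[ j < bound ] (coeff i j * x ^ toℕ i * y ^ toℕ j)

module Testing {c ℓ₁ ℓ₂} (R : RealNumbers c ℓ₁ ℓ₂) where
  open RealNumbers R

  -- The set [n] is represented by Fin n.
  record Distribution (n : ℕ) : Set (c ⊔ℓ ℓ₁ ⊔ℓ ℓ₂) where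
    field
      mass     : Fin n → Carrier
      mass-≥0  : ∀ i → 0# ≤ mass i
      mass-sum : ∑[ i < n ] mass i ≈ 1#

    measure : Subset n → Carrier
    measure A = ∑[ i < n ] (if does (i ∈? A) then mass i else 0#)

  open Distribution public

  distance : ∀ {n} → Distribution n → Distribution n → Carrier
  distance {n} μ μ′ = (1/ℕ 2) * (∑[ i < n ] ∣ mass μ i - mass μ′ i ∣ᴿ)

  Property : ∀ p → Set (c ⊔ℓ ℓ₁ ⊔ℓ ℓ₂ ⊔ℓ sucℓ p)
  Property p = ∀ n .{{_ : NonZero n}} → Pred (Distribution n) p

  Far : ∀ {p n} → Carrier → Pred (Distribution n) p → Pred (Distribution n) _
  Far ε P μ = ∀ μ′ → P μ′ → ε ≤ distance μ μ′

  -- Membership of μ in {Uₙ}.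
  IsUniform : Property ℓ₁
  IsUniform n μ = ∀ i → mass μ i ≈ 1/ℕ n

  1/∣_∣ : ∀ {n} (A : Subset n) → Nonempty A → Carrier
  1/∣ A ∣ (_ , x∈A) = 1/ℕ_ ∣ A ∣
    {{>-nonZero (ℕ.≤-<-trans ℕ.z≤n (x∈p⇒∣p-x∣<∣p∣ x∈A))}}

  -- The law of the sample returned for each query.  Independence of different
  -- samples is built into `Pr` below, which multiplies their probabilities.
  record ConditionalOracle {n} (μ : Distribution n) : Set (c ⊔ℓ ℓ₁ ⊔ℓ ℓ₂) where
    field
      law         : (A : Subset n) → Nonempty A → Distribution n
      law-outside : ∀ A ne j → j ∉ A → mass (law A ne) j ≈ 0#
      law-pos     : ∀ A ne j → j ∈ A → (0<μA : 0# < measure μ A) →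
                    mass (law A ne) j ≈ mass μ j * recip (measure μ A) 0<μA
      law-null    : ∀ A ne j → j ∈ A → measure μ A ≈ 0# →
                    mass (law A ne) j ≈ 1/∣ A ∣ ne

  -- A randomised adaptive algorithm making exactly t conditional queries, as a
  -- decision tree.  `toss k` is an internal coin toss, uniform on k + 1 outcomes;
  -- `output true` accepts and `output false` rejects.
  data Algorithm (n : ℕ) : ℕ → Set where
    output : Bool → Algorithm n 0
    toss   : ∀ {t} (k : ℕ) → (Fin (suc k) → Algorithm n t) → Algorithm n t
    query  : ∀ {t} (A : Subset n) → Nonempty A → (Fin n → Algorithm n t) →
             Algorithm n (suc t)

  module _ {n} {μ : Distribution n} (O : ConditionalOracle μ) where
    open ConditionalOracle O

    -- The probability that the algorithm, run with oracle O, outputs b.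
    Pr : ∀ {t} → Bool → Algorithm n t → Carrier
    Pr b (output b′)    = if does (b′ ≟ b) then 1# else 0#
    Pr b (toss k next)  = (1/ℕ suc k) * (∑[ i < suc k ] Pr b (next i))
    Pr b (query A ne next) = ∑[ j < n ] (mass (law A ne) j * Pr b (next j))

  record Tester {p} (P : Property p) : Set (c ⊔ℓ ℓ₁ ⊔ℓ ℓ₂ ⊔ℓ p) where
    field
      complexity : ∀ ε → 0# < ε → ∀ δ → 0# < δ → ∀ n .{{_ : NonZero n}} → ℕ
      algorithm  : ∀ ε (0<ε : 0# < ε) δ (0<δ : 0# < δ) n .{{_ : NonZero n}} →
                   Algorithm n (complexity ε 0<ε δ 0<δ n)
      accepts    : ∀ ε (0<ε : 0# < ε) δ (0<δ : 0# < δ) n .{{_ : NonZero n}}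
                   (μ : Distribution n) (O : ConditionalOracle μ) → P n μ →
                   1# - δ ≤ Pr O true (algorithm ε 0<ε δ 0<δ n)
      rejects    : ∀ ε (0<ε : 0# < ε) δ (0<δ : 0# < δ) n .{{_ : NonZero n}}
                   (μ : Distribution n) (O : ConditionalOracle μ) → Far ε (P n) μ →
                   1# - δ ≤ Pr O false (algorithm ε 0<ε δ 0<δ n)

{-# OPTIONS --safe #-}
module Submission where

-- Draw x from μ, y uniformly and z from μ conditioned on {x , y}; the outcome is heads if
-- z = x (and a fair coin decides if x = y).  Let f(x,y) be the probability of heads given x
-- and y, so that f(x,y) (μ(x) + μ(y)) = μ(x), and let q be that of heads.  If μ is uniform,
-- q = 1/2.  Symmetrising, 2q − 1 = (1/2n) ∑ (μ(x) − μ(y))² / (μ(x) + μ(y)), and AM-GM bounds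
-- this below by ε² if μ is ε-far from uniform.
--
-- A gambler who starts with capital 1 and always bets the fraction 1/N of it on heads, where
-- 2/N ≤ ε², ends with capital W.  The tester accepts iff W < 2^L, where 2^L > 1/δ.  If
-- q = 1/2 then E[W] = 1, and if 2q − 1 ≥ 2/N then E[1/W] is exponentially small in the number
-- of rounds divided by N², so Markov's inequality bounds both errors.

-- Betting replaces counting heads because W is a product: the means of W and of 1/W change by one
-- factor per round, so both tail bounds are inductions over the decision tree, with an integer
-- capital and no exponential estimates. At the smallest admissible bias 2/N a round multiplies the
-- mean of 1/W by (N² - 2)/(N² - 1), so about N² rounds halve it; as N is of order 1/ε², the number
-- of queries grows like the fourth power of 1/ε.
--
-- A pair may have mass zero, so f enters only through f(x,y) (μ(x) + μ(y)) = μ(x), without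
-- division. AM-GM appears as the nonnegativity of (μ(x) + μ(y)) (2f - 1 - τ)² with a free parameter
-- τ. Its sign is chosen only after summation over y, separately for each x; this produces |μ(x) -
-- 1/n|, hence the variation distance itself, and no factor depending on n is lost.
--
-- The order is not assumed decidable, so the integer parameters come from approximate ceilings with
-- a slack of one index.

open import Defs
open import Algebra.Bundles using (CommutativeRing)
import Algebra.Properties.AbelianGroup as AbelianGroupProperties
import Algebra.Properties.Ring as RingProperties
import Algebra.Properties.Semiring.Mult as Mult
import Algebra.Properties.Semiring.Sum as Sum
import Algebra.Solver.Ring as RingSolver
open import Algebra.Solver.Ring.AlmostCommutativeRing
  using (fromCommutativeRing; _-Raw-AlmostCommutative⟶_)
open import Data.Bool.Base using (Bool; true; false; if_then_else_)
open import Data.Empty using (⊥-elim)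
open import Data.Fin.Base as Fin using (Fin; toℕ)
import Data.Fin.Properties as Fin
open import Data.Fin.Subset using (Subset; _∈_; ⊤; ⁅_⁆; _∪_)
open import Data.Fin.Subset.Properties using (_∈?_; ∈⊤; x∈⁅x⁆; x∈⁅y⁆⇒x≡y; x∈p∪q⁺; x∈p∪q⁻)
open import Data.Integer.Base as ℤ using (ℤ; -[1+_]) renaming (+_ to pos)
import Data.Integer.Properties as ℤ
open import Data.Maybe.Base using (Maybe; just; nothing)
open import Data.Nat.Base as ℕ using (ℕ; zero; suc; NonZero; _!)
import Data.Nat.Properties as ℕ
open import Data.Nat.Solver using (module +-*-Solver)
open import Data.Product.Base using (Σ-syntax; ∃-syntax; _×_; _,_; proj₁; proj₂)
open import Data.Sum.Base using (_⊎_; inj₁; inj₂; [_,_]′)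
open import Data.Vec.Base using (_∷_; []; lookup)
open import Function.Base using (_∘_; case_of_)
import Relation.Binary.Reasoning.Base.Triple as Triple
import Relation.Binary.Reasoning.Setoid as SetoidReasoning
open import Relation.Binary.PropositionalEquality.Core as ≡ using (_≡_)
open import Relation.Binary.Structures using (IsPreorder)
open import Relation.Nullary.Decidable using (dec-true; dec-false)
open import Relation.Nullary.Decidable.Core using (yes; no; does)
open import Relation.Nullary.Negation.Core using (¬_)
open import Relation.Nullary.Reflects using (ofʸ; ofⁿ)
open import Algebra.Properties.CommutativeSemigroup ℕ.*-commutativeSemigroup using (x∙yz≈y∙xz)

-- Inequalities between natural numbers.

-- Bernoulli's inequality (1 + 1/b)^j ≥ 1 + j/b, multiplied by b^(j+1).
bernoulli : ∀ b j → (b ℕ.+ j) ℕ.* b ℕ.^ j ℕ.≤ b ℕ.* suc b ℕ.^ j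
bernoulli b zero    = ℕ.≤-reflexive (≡.cong (ℕ._* 1) (ℕ.+-identityʳ b))
bernoulli b (suc j) = begin
  (b ℕ.+ suc j) ℕ.* (b ℕ.* b ℕ.^ j)
    ≤⟨ ℕ.m≤m+n _ (j ℕ.* b ℕ.^ j) ⟩
  (b ℕ.+ suc j) ℕ.* (b ℕ.* b ℕ.^ j) ℕ.+ j ℕ.* b ℕ.^ j
    ≡⟨ solve 3 (λ b j p → (b :+ (con 1 :+ j)) :* (b :* p) :+ j :* p
                            := (con 1 :+ b) :* ((b :+ j) :* p)) ≡.refl b j (b ℕ.^ j) ⟩
  suc b ℕ.* ((b ℕ.+ j) ℕ.* b ℕ.^ j)
    ≤⟨ ℕ.*-monoʳ-≤ (suc b) (bernoulli b j) ⟩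
  suc b ℕ.* (b ℕ.* suc b ℕ.^ j)
    ≡⟨ solve 3 (λ a b p → a :* (b :* p) := b :* (a :* p)) ≡.refl (suc b) b (suc b ℕ.^ j) ⟩
  b ℕ.* suc b ℕ.^ suc j ∎
  where
  open ℕ.≤-Reasoning
  open +-*-Solver

2*b^b≤[1+b]^b : ∀ b .{{_ : NonZero b}} → 2 ℕ.* b ℕ.^ b ℕ.≤ suc b ℕ.^ b
2*b^b≤[1+b]^b b = ℕ.*-cancelˡ-≤ b (begin
  b ℕ.* (2 ℕ.* b ℕ.^ b)    ≡⟨ solve 2 (λ b p → b :* (con 2 :* p) := (b :+ b) :* p) ≡.refl b (b ℕ.^ b) ⟩
  (b ℕ.+ b) ℕ.* b ℕ.^ b    ≤⟨ bernoulli b b ⟩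
  b ℕ.* suc b ℕ.^ b        ∎)
  where
  open ℕ.≤-Reasoning
  open +-*-Solver

[m*n]^o≡m^o*n^o : ∀ m n o → (m ℕ.* n) ℕ.^ o ≡ m ℕ.^ o ℕ.* n ℕ.^ o
[m*n]^o≡m^o*n^o m n zero    = ≡.refl
[m*n]^o≡m^o*n^o m n (suc o) = ≡.trans (≡.cong (m ℕ.* n ℕ.*_) ([m*n]^o≡m^o*n^o m n o))
  (solve 4 (λ m n p q → m :* n :* (p :* q) := m :* p :* (n :* q)) ≡.refl m n (m ℕ.^ o) (n ℕ.^ o))
  where open +-*-Solver

n<2^n : ∀ n → n ℕ.< 2 ℕ.^ n
n<2^n zero    = ℕ.s≤s ℕ.z≤n
n<2^n (suc n) = begin
  2 ℕ.+ n                  ≤⟨ ℕ.+-mono-≤ (ℕ.m^n>0 2 n) (n<2^n n) ⟩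
  2 ℕ.^ n ℕ.+ 2 ℕ.^ n      ≡⟨ ≡.cong (2 ℕ.^ n ℕ.+_) (ℕ.+-identityʳ _) ⟨
  2 ℕ.* 2 ℕ.^ n            ∎
  where open ℕ.≤-Reasoning

-- Up to j = m the power is at most m^m; beyond that, each further factor m is absorbed by a factor
-- of the factorial that is at least m.
m^j≤j!*m^m : ∀ m j → m ℕ.^ j ℕ.≤ j ! ℕ.* m ℕ.^ m
m^j≤j!*m^m zero    zero    = ℕ.≤-refl
m^j≤j!*m^m (suc m) zero    = ℕ.≤-trans (ℕ.m^n>0 (suc m) (suc m)) (ℕ.m≤n*m _ 1)
m^j≤j!*m^m m       (suc j) with suc j ℕ.≤? m
... | no  j≮m = ℕ.≤-trans (ℕ.*-mono-≤ (ℕ.<⇒≤ (ℕ.≰⇒> j≮m)) (m^j≤j!*m^m m j))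
                  (ℕ.≤-reflexive (≡.sym (ℕ.*-assoc (suc j) (j !) (m ℕ.^ m))))
... | yes j<m = ℕ.≤-trans (ℕ.^-monoʳ-≤ m {{ℕ.>-nonZero (ℕ.≤-<-trans ℕ.z≤n j<m)}} j<m)
                  (ℕ.m≤n*m _ (suc j !) {{ℕ._!≢0 (suc j)}})

m^m≤2^[m*m] : ∀ m → m ℕ.^ m ℕ.≤ 2 ℕ.^ (m ℕ.* m)
m^m≤2^[m*m] m = ℕ.≤-trans (ℕ.^-monoˡ-≤ m (ℕ.<⇒≤ (n<2^n m))) (ℕ.≤-reflexive (ℕ.^-*-assoc 2 m m))

-- The martingale property in integers: 3 + w and 1 + w average to 2 + w.
step-average : ∀ a w p → a ℕ.* (3 ℕ.+ w) ℕ.* p ℕ.+ a ℕ.* (1 ℕ.+ w) ℕ.* p ≡ 2 ℕ.* (a ℕ.* ((2 ℕ.+ w) ℕ.* p))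
step-average = solve 3 (λ a w p →
  a :* (con 3 :+ w) :* p :+ a :* (con 1 :+ w) :* p := con 2 :* (a :* ((con 2 :+ w) :* p))) ≡.refl
  where open +-*-Solver

-- (1 + 1/b)^(2bL) ≥ 4^L for b = (2 + w)² − 2.
growth : ∀ w L → let b = 2 ℕ.+ w ℕ.* (4 ℕ.+ w); T = b ℕ.* (2 ℕ.* L); N = 2 ℕ.+ w in
  N ℕ.^ T ℕ.* b ℕ.^ T ℕ.* (2 ℕ.^ L ℕ.* 2 ℕ.^ L) ℕ.≤ (N ℕ.* ((1 ℕ.+ w) ℕ.* (3 ℕ.+ w))) ℕ.^ T
growth w L = begin
  N ℕ.^ T ℕ.* b ℕ.^ T ℕ.* (2 ℕ.^ L ℕ.* 2 ℕ.^ L)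
    ≡⟨ solve 3 (λ p q r → p :* q :* (r :* r) := p :* (r :* (r :* con 1) :* q)) ≡.refl (N ℕ.^ T) (b ℕ.^ T) (2 ℕ.^ L) ⟩
  N ℕ.^ T ℕ.* ((2 ℕ.^ L) ℕ.^ 2 ℕ.* b ℕ.^ T)
    ≡⟨ ≡.cong (N ℕ.^ T ℕ.*_) (≡.cong₂ ℕ._*_
         (≡.trans (ℕ.^-*-assoc 2 L 2) (≡.cong (2 ℕ.^_) (ℕ.*-comm L 2))) (≡.sym (ℕ.^-*-assoc b b (2 ℕ.* L)))) ⟩
  N ℕ.^ T ℕ.* (2 ℕ.^ (2 ℕ.* L) ℕ.* (b ℕ.^ b) ℕ.^ (2 ℕ.* L))
    ≡⟨ ≡.cong (N ℕ.^ T ℕ.*_) ([m*n]^o≡m^o*n^o 2 (b ℕ.^ b) (2 ℕ.* L)) ⟨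
  N ℕ.^ T ℕ.* (2 ℕ.* b ℕ.^ b) ℕ.^ (2 ℕ.* L)
    ≤⟨ ℕ.*-monoʳ-≤ (N ℕ.^ T) (ℕ.^-monoˡ-≤ (2 ℕ.* L) (2*b^b≤[1+b]^b b)) ⟩
  N ℕ.^ T ℕ.* (suc b ℕ.^ b) ℕ.^ (2 ℕ.* L)
    ≡⟨ ≡.cong (N ℕ.^ T ℕ.*_) (ℕ.^-*-assoc (suc b) b (2 ℕ.* L)) ⟩
  N ℕ.^ T ℕ.* suc b ℕ.^ T
    ≡⟨ [m*n]^o≡m^o*n^o N (suc b) T ⟨
  (N ℕ.* suc b) ℕ.^ T
    ≡⟨ ≡.cong (λ c → (N ℕ.* c) ℕ.^ T) (solve 1 (λ w → con 1 :+ (con 2 :+ w :* (con 4 :+ w))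
         := (con 1 :+ w) :* (con 3 :+ w)) ≡.refl w) ⟩
  (N ℕ.* ((1 ℕ.+ w) ℕ.* (3 ℕ.+ w))) ℕ.^ T ∎
  where
  open ℕ.≤-Reasoning
  open +-*-Solver
  b = 2 ℕ.+ w ℕ.* (4 ℕ.+ w)
  T = b ℕ.* (2 ℕ.* L)
  N = 2 ℕ.+ w

capital-regroup : ∀ p q r → r ℕ.* p ℕ.* q ℕ.* r ≡ p ℕ.* q ℕ.* (r ℕ.* r)
capital-regroup = solve 3 (λ p q r → r :* p :* q :* r := p :* q :* (r :* r)) ≡.refl
  where open +-*-Solver

module RealProperties {c ℓ₁ ℓ₂} (R : RealNumbers c ℓ₁ ℓ₂) where
  open RealNumbers R
  open CommutativeRing commutativeRing
    using ( refl; sym; trans; +-cong; +-congˡ; +-congʳ; *-cong; *-congˡ; *-congʳ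
          ; -‿cong; *-comm; +-comm; +-assoc; *-identityˡ
          ; +-identityʳ; -‿inverseʳ; zeroˡ; zeroʳ; ring
          ; +-abelianGroup; reflexive; isEquivalence )
  open Mult semiring using (×-homo-+; ×1-homo-*)
  open Sum semiring using (sum; sum-cong-≋; ∑-distrib-+; *-distribˡ-sum)
  open AbelianGroupProperties +-abelianGroup using (⁻¹-∙-comm; ε⁻¹≈ε; ⁻¹-involutive)
  open RingProperties ring using (-‿distribʳ-*; -‿distribˡ-*)

  -- Integer literals in the reals and the ring solver.

  fromℕ-+ : ∀ m n → fromℕ (m ℕ.+ n) ≈ fromℕ m + fromℕ n
  fromℕ-+ = ×-homo-+ 1#

  fromℕ-* : ∀ m n → fromℕ (m ℕ.* n) ≈ fromℕ m * fromℕ n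
  fromℕ-* = ×1-homo-*

  fromℤ : ℤ → Carrier
  fromℤ (pos n)   = fromℕ n
  fromℤ -[1+ n ] = - fromℕ (suc n)

  fromℤ-neg : ∀ i → fromℤ (ℤ.- i) ≈ - fromℤ i
  fromℤ-neg (pos zero)    = sym ε⁻¹≈ε
  fromℤ-neg (pos (suc n)) = refl
  fromℤ-neg -[1+ n ]     = sym (⁻¹-involutive _)

  fromℤ-⊖ : ∀ m n → fromℤ (m ℤ.⊖ n) ≈ fromℕ m - fromℕ n
  fromℤ-⊖ m       zero    = sym (trans (+-congˡ ε⁻¹≈ε) (+-identityʳ _))
  fromℤ-⊖ zero    (suc n) = sym (+-identityˡ _)
  fromℤ-⊖ (suc m) (suc n) = begin
    fromℤ (suc m ℤ.⊖ suc n)                ≡⟨ ≡.cong fromℤ (ℤ.[1+m]⊖[1+n]≡m⊖n m n) ⟩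
    fromℤ (m ℤ.⊖ n)                        ≈⟨ fromℤ-⊖ m n ⟩
    fromℕ m - fromℕ n                      ≈⟨ +-congʳ (+-identityˡ _) ⟨
    0# + fromℕ m - fromℕ n                 ≈⟨ +-congʳ (+-congʳ (-‿inverseʳ 1#)) ⟨
    1# - 1# + fromℕ m - fromℕ n            ≈⟨ +-congʳ (trans (+-assoc _ _ _) (+-congˡ (+-comm _ _))) ⟩
    1# + (fromℕ m - 1#) - fromℕ n          ≈⟨ trans (+-congʳ (sym (+-assoc _ _ _))) (+-assoc _ _ _) ⟩
    fromℕ (suc m) + (- 1# - fromℕ n)       ≈⟨ +-congˡ (⁻¹-∙-comm _ _) ⟩
    fromℕ (suc m) - fromℕ (suc n)          ∎
    where open SetoidReasoning setoid

  fromℤ-+ : ∀ i j → fromℤ (i ℤ.+ j) ≈ fromℤ i + fromℤ j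
  fromℤ-+ (pos m)   (pos n)   = fromℕ-+ m n
  fromℤ-+ (pos m)   -[1+ n ] = fromℤ-⊖ m (suc n)
  fromℤ-+ -[1+ m ] (pos n)   = trans (fromℤ-⊖ n (suc m)) (+-comm _ _)
  fromℤ-+ -[1+ m ] -[1+ n ] = begin
    - fromℕ (suc (suc (m ℕ.+ n)))      ≡⟨ ≡.cong (λ k → - fromℕ (suc k)) (ℕ.+-suc m n) ⟨
    - fromℕ (suc m ℕ.+ suc n)          ≈⟨ -‿cong (fromℕ-+ (suc m) (suc n)) ⟩
    - (fromℕ (suc m) + fromℕ (suc n))  ≈⟨ ⁻¹-∙-comm _ _ ⟨
    - fromℕ (suc m) - fromℕ (suc n)    ∎
    where open SetoidReasoning setoid

  fromℤ-* : ∀ i j → fromℤ (i ℤ.* j) ≈ fromℤ i * fromℤ j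
  fromℤ-* i (pos n) = lemma i
    where
    lemma : ∀ i → fromℤ (i ℤ.* pos n) ≈ fromℤ i * fromℕ n
    lemma (pos m) = trans (reflexive (≡.cong fromℤ (≡.sym (ℤ.pos-* m n)))) (fromℕ-* m n)
    lemma -[1+ m ] = begin
      fromℤ (-[1+ m ] ℤ.* pos n)         ≡⟨ ≡.cong fromℤ (ℤ.neg-distribˡ-* (pos (suc m)) (pos n)) ⟨
      fromℤ (ℤ.- (pos (suc m) ℤ.* pos n)) ≈⟨ fromℤ-neg (pos (suc m) ℤ.* pos n) ⟩
      - fromℤ (pos (suc m) ℤ.* pos n)     ≈⟨ -‿cong (lemma (pos (suc m))) ⟩
      - (fromℕ (suc m) * fromℕ n)       ≈⟨ -‿distribˡ-* _ _ ⟩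
      - fromℕ (suc m) * fromℕ n         ∎
      where open SetoidReasoning setoid
  fromℤ-* i -[1+ n ] = begin
    fromℤ (i ℤ.* -[1+ n ])            ≡⟨ ≡.cong fromℤ (ℤ.neg-distribʳ-* i (pos (suc n))) ⟨
    fromℤ (ℤ.- (i ℤ.* pos (suc n)))     ≈⟨ fromℤ-neg (i ℤ.* pos (suc n)) ⟩
    - fromℤ (i ℤ.* pos (suc n))        ≈⟨ -‿cong (fromℤ-* i (pos (suc n))) ⟩
    - (fromℤ i * fromℕ (suc n))      ≈⟨ -‿distribʳ-* _ _ ⟩
    fromℤ i * - fromℕ (suc n)        ∎
    where open SetoidReasoning setoid

  -- The value at 1 is 1# itself, so that the solver's constants are literally 0#, 1#, fromℕ 2, ….
  literal : ℤ → Carrier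
  literal (pos 1) = 1#
  literal i       = fromℤ i

  literal≈fromℤ : ∀ i → literal i ≈ fromℤ i
  literal≈fromℤ (pos 0)             = refl
  literal≈fromℤ (pos 1)             = sym (+-identityʳ 1#)
  literal≈fromℤ (pos (suc (suc n))) = refl
  literal≈fromℤ -[1+ n ]            = refl

  -- Coefficients are taken in ℤ because equality is decidable there, which lets the solver
  -- recognise that coefficients cancel.
  literal-homomorphism : ℤ.+-*-rawRing -Raw-AlmostCommutative⟶ fromCommutativeRing commutativeRing
  literal-homomorphism = record
    { ⟦_⟧    = literal
    ; +-homo = λ i j → trans (literal≈fromℤ (i ℤ.+ j)) (trans (fromℤ-+ i j)
                 (sym (+-cong (literal≈fromℤ i) (literal≈fromℤ j))))
    ; *-homo = λ i j → trans (literal≈fromℤ (i ℤ.* j)) (trans (fromℤ-* i j)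
                 (sym (*-cong (literal≈fromℤ i) (literal≈fromℤ j))))
    ; -‿homo = λ i → trans (literal≈fromℤ (ℤ.- i)) (trans (fromℤ-neg i)
                 (sym (-‿cong (literal≈fromℤ i))))
    ; 0-homo = refl
    ; 1-homo = refl
    }

  literal-≟ : ∀ i j → Maybe (literal i ≈ literal j)
  literal-≟ i j with i ℤ.≟ j
  ... | yes i≡j = just (reflexive (≡.cong literal i≡j))
  ... | no _    = nothing

  module Solver = RingSolver _ _ literal-homomorphism literal-≟
  open Solver using (solve; _:=_; _:+_; _:*_; _:-_; :-_; con)

  -- The order and its compatibility with the field operations.

  cotrans : ∀ {x y} → x < y → ∀ z → x < z ⊎ z < y
  cotrans x<y z with #-cotrans (<⊎>⇒# (inj₁ x<y)) z
  ... | inj₁ x#z = case #⇒<⊎> x#z of λ where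
    (inj₁ x<z) → inj₁ x<z
    (inj₂ z<x) → inj₂ (<-trans z<x x<y)
  ... | inj₂ z#y = case #⇒<⊎> z#y of λ where
    (inj₁ z<y) → inj₂ z<y
    (inj₂ y<z) → inj₁ (<-trans x<y y<z)

  -- Since x ≤ y is a negation, it may be proved by classical case distinctions.
  by-cases : ∀ {a x y} (A : Set a) → (A → x ≤ y) → (¬ A → x ≤ y) → x ≤ y
  by-cases A f g y<x = g (λ a → f a y<x) y<x

  ≤-reflexive : ∀ {x y} → x ≈ y → x ≤ y
  ≤-reflexive x≈y = <-irrefl (sym x≈y)

  ≤-refl : ∀ {x} → x ≤ x
  ≤-refl = ≤-reflexive refl

  ≤-trans : ∀ {x y z} → x ≤ y → y ≤ z → x ≤ z
  ≤-trans {y = y} x≤y y≤z z<x with cotrans z<x y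
  ... | inj₁ z<y = y≤z z<y
  ... | inj₂ y<x = x≤y y<x

  ≤-antisym : ∀ {x y} → x ≤ y → y ≤ x → x ≈ y
  ≤-antisym x≤y y≤x = proj₁ (tight _ _) λ x#y → case #⇒<⊎> x#y of λ where
    (inj₁ x<y) → y≤x x<y
    (inj₂ y<x) → x≤y y<x

  -- By tightness of the apartness, equality amounts to two inequalities, each of them a negation.
  ≈-by-cases : ∀ {a x y} (A : Set a) → (A → x ≈ y) → (¬ A → x ≈ y) → x ≈ y
  ≈-by-cases A f g = ≤-antisym
    (by-cases A (≤-reflexive ∘ f) (≤-reflexive ∘ g))
    (by-cases A (≤-reflexive ∘ sym ∘ f) (≤-reflexive ∘ sym ∘ g))

  <⇒≤ : ∀ {x y} → x < y → x ≤ y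
  <⇒≤ = <-asym

  <-≤-trans : ∀ {x y z} → x < y → y ≤ z → x < z
  <-≤-trans {z = z} x<y y≤z with cotrans x<y z
  ... | inj₁ x<z = x<z
  ... | inj₂ z<y = ⊥-elim (y≤z z<y)

  ≤-<-trans : ∀ {x y z} → x ≤ y → y < z → x < z
  ≤-<-trans {x} x≤y y<z with cotrans y<z x
  ... | inj₁ y<x = ⊥-elim (x≤y y<x)
  ... | inj₂ x<z = x<z

  ≤-isPreorder : IsPreorder _≈_ _≤_
  ≤-isPreorder = record
    { isEquivalence = isEquivalence ; reflexive = ≤-reflexive ; trans = ≤-trans }

  module ≤-Reasoning =
    Triple ≤-isPreorder <-asym <-trans <-resp-≈ <⇒≤ <-≤-trans ≤-<-trans

  +-monoˡ-≤ : ∀ z {x y} → x ≤ y → x + z ≤ y + z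
  +-monoˡ-≤ z {x} {y} x≤y y+z<x+z = x≤y (<-respˡ-≈ (cancel y) (<-respʳ-≈ (cancel x) (+-monoˡ-< (- z) y+z<x+z)))
    where
    cancel : ∀ w → w + z + - z ≈ w
    cancel w = solve 2 (λ w z → w :+ z :+ :- z := w) refl w z

  +-mono-≤ : ∀ {x y u v} → x ≤ y → u ≤ v → x + u ≤ y + v
  +-mono-≤ {x} {y} {u} {v} x≤y u≤v = begin
    x + u  ≤⟨ +-monoˡ-≤ u x≤y ⟩
    y + u  ≈⟨ +-comm y u ⟩
    u + y  ≤⟨ +-monoˡ-≤ y u≤v ⟩
    v + y  ≈⟨ +-comm v y ⟩
    y + v  ∎
    where open ≤-Reasoning

  x≤y⇒0≤y-x : ∀ {x y} → x ≤ y → 0# ≤ y - x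
  x≤y⇒0≤y-x {x} {y} x≤y = begin
    0#     ≈⟨ -‿inverseʳ x ⟨
    x - x  ≤⟨ +-monoˡ-≤ (- x) x≤y ⟩
    y - x  ∎
    where open ≤-Reasoning

  0≤y-x⇒x≤y : ∀ {x y} → 0# ≤ y - x → x ≤ y
  0≤y-x⇒x≤y {x} {y} 0≤y-x = begin
    x          ≈⟨ +-identityˡ x ⟨
    0# + x     ≤⟨ +-monoˡ-≤ x 0≤y-x ⟩
    y - x + x  ≈⟨ solve 2 (λ x y → y :- x :+ x := y) refl x y ⟩
    y          ∎
    where open ≤-Reasoning

  x<y⇒0<y-x : ∀ {x y} → x < y → 0# < y - x
  x<y⇒0<y-x {x} x<y = <-respˡ-≈ (-‿inverseʳ x) (+-monoˡ-< (- x) x<y)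

  0≤-* : ∀ {x y} → 0# ≤ x → 0# ≤ y → 0# ≤ x * y
  0≤-* {x} {y} 0≤x 0≤y = by-cases (0# < x)
    (λ 0<x → by-cases (0# < y) (<⇒≤ ∘ *-pos 0<x)
      λ y≤0 → ≤-reflexive (trans (sym (zeroʳ x)) (*-congˡ (≤-antisym 0≤y y≤0))))
    λ x≤0 → ≤-reflexive (trans (sym (zeroˡ y)) (*-congʳ (≤-antisym 0≤x x≤0)))

  *-monoˡ-≤ : ∀ {x y z} → 0# ≤ z → x ≤ y → z * x ≤ z * y
  *-monoˡ-≤ {x} {y} {z} 0≤z x≤y = 0≤y-x⇒x≤y (begin
    0#             ≤⟨ 0≤-* 0≤z (x≤y⇒0≤y-x x≤y) ⟩
    z * (y - x)    ≈⟨ solve 3 (λ x y z → z :* (y :- x) := z :* y :- z :* x) refl x y z ⟩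
    z * y - z * x  ∎)
    where open ≤-Reasoning

  *-mono-≤ : ∀ {x y u v} → 0# ≤ x → 0# ≤ u → x ≤ y → u ≤ v → x * u ≤ y * v
  *-mono-≤ {x} {y} {u} {v} 0≤x 0≤u x≤y u≤v = begin
    x * u  ≤⟨ *-monoˡ-≤ 0≤x u≤v ⟩
    x * v  ≈⟨ *-comm x v ⟩
    v * x  ≤⟨ *-monoˡ-≤ (≤-trans 0≤u u≤v) x≤y ⟩
    v * y  ≈⟨ *-comm v y ⟩
    y * v  ∎
    where open ≤-Reasoning

  *-monoˡ-< : ∀ {x y z} → 0# < z → x < y → z * x < z * y
  *-monoˡ-< {x} {y} {z} 0<z x<y = <-respˡ-≈ (+-identityˡ _) (<-respʳ-≈
    (solve 3 (λ x y z → z :* (y :- x) :+ z :* x := z :* y) refl x y z)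
    (+-monoˡ-< (z * x) (*-pos 0<z (x<y⇒0<y-x x<y))))

  *-cancelˡ-≤ : ∀ {x y z} → 0# < z → z * x ≤ z * y → x ≤ y
  *-cancelˡ-≤ 0<z zx≤zy y<x = zx≤zy (*-monoˡ-< 0<z y<x)

  *-cancelˡ-≈ : ∀ {x y z} → 0# < z → z * x ≈ z * y → x ≈ y
  *-cancelˡ-≈ 0<z zx≈zy =
    ≤-antisym (*-cancelˡ-≤ 0<z (≤-reflexive zx≈zy)) (*-cancelˡ-≤ 0<z (≤-reflexive (sym zx≈zy)))

  x≤0⇒0≤-x : ∀ {x} → x ≤ 0# → 0# ≤ - x
  x≤0⇒0≤-x x≤0 = ≤-trans (x≤y⇒0≤y-x x≤0) (≤-reflexive (+-identityˡ _))

  0≤x² : ∀ x → 0# ≤ x * x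
  0≤x² x = by-cases (0# < x) (λ 0<x → <⇒≤ (*-pos 0<x 0<x)) λ x≤0 →
    ≤-trans (0≤-* (x≤0⇒0≤-x x≤0) (x≤0⇒0≤-x x≤0))
      (≤-reflexive (solve 1 (λ x → (:- x) :* (:- x) := x :* x) refl x))

  -- The products (a - x)(b + y) and (a + x)(b - y) are nonnegative and add up to 2 (a b - x y), so
  -- no case distinction on signs is needed.
  *-mono-∣∣ : ∀ {x y a b} → x ≤ a → - x ≤ a → y ≤ b → - y ≤ b → x * y ≤ a * b
  *-mono-∣∣ {x} {y} {a} {b} x≤a -x≤a y≤b -y≤b = *-cancelˡ-≤ (0<fromℕ-suc 1) (0≤y-x⇒x≤y (begin
    0#  ≈⟨ +-identityʳ 0# ⟨
    0# + 0#
      ≤⟨ +-mono-≤ (0≤-* (x≤y⇒0≤y-x x≤a) (x≤y⇒0≤y-x -y≤b)) (0≤-* (x≤y⇒0≤y-x -x≤a) (x≤y⇒0≤y-x y≤b)) ⟩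
    (a - x) * (b - - y) + (a - - x) * (b - y)
      ≈⟨ solve 4 (λ x y a b → (a :- x) :* (b :- (:- y)) :+ (a :- (:- x)) :* (b :- y)
                   := con (pos 2) :* (a :* b) :- con (pos 2) :* (x :* y)) refl x y a b ⟩
    fromℕ 2 * (a * b) - fromℕ 2 * (x * y) ∎))
    where open ≤-Reasoning

  -- Absolute values.

  x≤∣x∣ : ∀ x → x ≤ ∣ x ∣ᴿ
  x≤∣x∣ x = proj₁ (⊔-supremum x (- x))

  -x≤∣x∣ : ∀ x → - x ≤ ∣ x ∣ᴿ
  -x≤∣x∣ x = proj₁ (proj₂ (⊔-supremum x (- x)))

  ∣x∣≤ : ∀ {x y} → x ≤ y → - x ≤ y → ∣ x ∣ᴿ ≤ y
  ∣x∣≤ = proj₂ (proj₂ (⊔-supremum _ _)) _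

  0≤x⇒∣x∣≤x : ∀ {x} → 0# ≤ x → ∣ x ∣ᴿ ≤ x
  0≤x⇒∣x∣≤x {x} 0≤x = ∣x∣≤ ≤-refl (0≤y-x⇒x≤y (begin
    0#         ≈⟨ +-identityʳ 0# ⟨
    0# + 0#    ≤⟨ +-mono-≤ 0≤x 0≤x ⟩
    x + x      ≈⟨ +-congˡ (⁻¹-involutive x) ⟨
    x - - x    ∎))
    where open ≤-Reasoning

  x≤0⇒∣x∣≤-x : ∀ {x} → x ≤ 0# → ∣ x ∣ᴿ ≤ - x
  x≤0⇒∣x∣≤-x x≤0 = ∣x∣≤ (≤-trans x≤0 (x≤0⇒0≤-x x≤0)) ≤-refl

  0≤∣x∣ : ∀ x → 0# ≤ ∣ x ∣ᴿ
  0≤∣x∣ x = by-cases (0# < x)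
    (λ 0<x → ≤-trans (<⇒≤ 0<x) (x≤∣x∣ x))
    (λ x≤0 → ≤-trans (x≤0⇒0≤-x x≤0) (-x≤∣x∣ x))

  *∣x∣≤ : ∀ {x y z} → 0# ≤ z → z * x ≤ y → z * - x ≤ y → z * ∣ x ∣ᴿ ≤ y
  *∣x∣≤ {x} 0≤z zx≤y z-x≤y = by-cases (0# < x)
    (λ 0<x → ≤-trans (*-monoˡ-≤ 0≤z (0≤x⇒∣x∣≤x (<⇒≤ 0<x))) zx≤y)
    (λ x≤0 → ≤-trans (*-monoˡ-≤ 0≤z (x≤0⇒∣x∣≤-x x≤0)) z-x≤y)

  ∣x∣²≤x² : ∀ x → ∣ x ∣ᴿ * ∣ x ∣ᴿ ≤ x * x
  ∣x∣²≤x² x = by-cases (0# < x)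
    (λ 0<x → let ∣x∣≤x = 0≤x⇒∣x∣≤x (<⇒≤ 0<x) in *-mono-≤ (0≤∣x∣ x) (0≤∣x∣ x) ∣x∣≤x ∣x∣≤x)
    (λ x≤0 → let ∣x∣≤-x = x≤0⇒∣x∣≤-x x≤0 in ≤-trans (*-mono-≤ (0≤∣x∣ x) (0≤∣x∣ x) ∣x∣≤-x ∣x∣≤-x)
      (≤-reflexive (solve 1 (λ x → (:- x) :* (:- x) := x :* x) refl x)))

  -- Natural numbers as reals, and reciprocals.

  0≤fromℕ : ∀ n → 0# ≤ fromℕ n
  0≤fromℕ zero    = ≤-refl
  0≤fromℕ (suc n) = <⇒≤ (0<fromℕ-suc n)

  fromℕ-mono-≤ : ∀ {m n} → m ℕ.≤ n → fromℕ m ≤ fromℕ n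
  fromℕ-mono-≤ {n = n} ℕ.z≤n = 0≤fromℕ n
  fromℕ-mono-≤ (ℕ.s≤s m≤n)   = +-mono-≤ ≤-refl (fromℕ-mono-≤ m≤n)

  n<1+n : ∀ n → fromℕ n < fromℕ (suc n)
  n<1+n n = <-respˡ-≈ (+-identityˡ _) (+-monoˡ-< (fromℕ n) 0<1)

  fromℕ-mono-< : ∀ {m n} → m ℕ.< n → fromℕ m < fromℕ n
  fromℕ-mono-< {m} m<n = <-≤-trans (n<1+n m) (fromℕ-mono-≤ m<n)

  fromℕ-cancel-< : ∀ {m n} → fromℕ m < fromℕ n → m ℕ.< n
  fromℕ-cancel-< x<y = ℕ.≰⇒> λ n≤m → fromℕ-mono-≤ n≤m x<y

  *-recip : ∀ x (0<x : 0# < x) → x * recip x 0<x ≈ 1#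
  *-recip x 0<x = trans
    (solve 2 (λ x y → x :* y := (x :- con (pos 0)) :* y) refl x (recip x 0<x))
    (proj₂ (proj₂ (#⇒invertible (<⊎>⇒# {x} {0#} (inj₂ 0<x)))))

  0≤recip : ∀ x (0<x : 0# < x) → 0# ≤ recip x 0<x
  0≤recip x 0<x = *-cancelˡ-≤ 0<x (begin
    x * 0#           ≈⟨ zeroʳ x ⟩
    0#               ≤⟨ <⇒≤ 0<1 ⟩
    1#               ≈⟨ *-recip x 0<x ⟨
    x * recip x 0<x  ∎)
    where open ≤-Reasoning

  *-1/ℕ : ∀ n .{{_ : NonZero n}} → fromℕ n * 1/ℕ n ≈ 1#
  *-1/ℕ (suc n) = *-recip _ (0<fromℕ-suc n)

  0≤1/ℕ : ∀ n .{{_ : NonZero n}} → 0# ≤ 1/ℕ n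
  0≤1/ℕ (suc n) = 0≤recip _ (0<fromℕ-suc n)

  0<fromℕ : ∀ n .{{_ : NonZero n}} → 0# < fromℕ n
  0<fromℕ (suc n) = 0<fromℕ-suc n

  -- Finite sums.

  sum-mono-≤ : ∀ {n} {f g : Fin n → Carrier} → (∀ i → f i ≤ g i) → sum f ≤ sum g
  sum-mono-≤ {zero}  f≤g = ≤-refl
  sum-mono-≤ {suc n} f≤g = +-mono-≤ (f≤g Fin.zero) (sum-mono-≤ (f≤g ∘ Fin.suc))

  sum-const : ∀ n x → ∑[ i < n ] x ≈ fromℕ n * x
  sum-const zero    x = sym (zeroˡ x)
  sum-const (suc n) x = trans (+-congˡ (sum-const n x))
    (solve 2 (λ k x → x :+ k :* x := (con (pos 1) :+ k) :* x) refl (fromℕ n) x)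

  sum-linear : ∀ {n} a b (f g : Fin n → Carrier) →
    ∑[ i < n ] (a * f i + b * g i) ≈ a * sum f + b * sum g
  sum-linear a b f g = trans (∑-distrib-+ (λ i → a * f i) (λ i → b * g i))
    (+-cong (sym (*-distribˡ-sum a f)) (sym (*-distribˡ-sum b g)))

  sum-0 : ∀ {n} {f : Fin n → Carrier} → (∀ i → f i ≈ 0#) → sum f ≈ 0#
  sum-0 {n} f≈0 = trans (sum-cong-≋ f≈0) (trans (sum-const n 0#) (zeroʳ _))

  sum-single : ∀ {n} {f : Fin n → Carrier} j → (∀ i → ¬ (i ≡ j) → f i ≈ 0#) → sum f ≈ f j
  sum-single {suc n} Fin.zero f≈0 =
    trans (+-congˡ (sum-0 λ i → f≈0 (Fin.suc i) λ ())) (+-identityʳ _)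
  sum-single {suc n} {f} (Fin.suc j) f≈0 =
    trans (+-cong (f≈0 Fin.zero λ ()) (sum-single j λ i i≢j → f≈0 (Fin.suc i) λ { ≡.refl → i≢j ≡.refl })) (+-identityˡ _)

  sum-nonneg : ∀ {n} {f : Fin n → Carrier} → (∀ i → 0# ≤ f i) → 0# ≤ sum f
  sum-nonneg {n} 0≤f = ≤-trans (≤-reflexive (sym (trans (sum-const n 0#) (zeroʳ _)))) (sum-mono-≤ 0≤f)

  term≤sum : ∀ {n} {f : Fin n → Carrier} → (∀ i → 0# ≤ f i) → ∀ i → f i ≤ sum f
  term≤sum {suc n} {f} 0≤f Fin.zero = ≤-trans (≤-reflexive (sym (+-identityʳ _)))
    (+-mono-≤ ≤-refl (sum-nonneg (0≤f ∘ Fin.suc)))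
  term≤sum {suc n} {f} 0≤f (Fin.suc i) = ≤-trans (≤-reflexive (sym (+-identityˡ _)))
    (+-mono-≤ (0≤f Fin.zero) (term≤sum (0≤f ∘ Fin.suc) i))

  sum-indicator : ∀ {n} (f : Fin n → Carrier) j →
    ∑[ i < n ] (if does (i Fin.≟ j) then f i else 0#) ≈ f j
  sum-indicator f j = trans
    (sum-single j λ i i≢j → reflexive (≡.cong (if_then f i else 0#) (dec-false (i Fin.≟ j) i≢j)))
    (reflexive (≡.cong (if_then f j else 0#) (dec-true (j Fin.≟ j) ≡.refl)))

  -- The tail, doubled, satisfies the same hypothesis with the same `b`. By induction twice the tail
  -- is at most 2 b, so the tail costs as much as the bound on the first term.
  geometric-bound : ∀ {n} {f : Fin n → Carrier} {b} → 0# ≤ b →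
    (∀ i → fromℕ (2 ℕ.^ toℕ i) * f i ≤ b) → sum f ≤ fromℕ 2 * b
  geometric-bound {zero}          0≤b f≤b = 0≤-* (0≤fromℕ 2) 0≤b
  geometric-bound {suc n} {f} {b} 0≤b f≤b = begin
    f Fin.zero + sum (f ∘ Fin.suc)
      ≤⟨ +-mono-≤ (≤-trans (≤-reflexive (sym (trans (*-congʳ (+-identityʳ 1#)) (*-identityˡ _)))) (f≤b Fin.zero))
                  (*-cancelˡ-≤ (0<fromℕ-suc 1) tail) ⟩
    b + b
      ≈⟨ solve 1 (λ b → b :+ b := con (pos 2) :* b) refl b ⟩
    fromℕ 2 * b ∎
    where
    open ≤-Reasoning
    tail : fromℕ 2 * sum (f ∘ Fin.suc) ≤ fromℕ 2 * b
    tail = begin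
      fromℕ 2 * sum (f ∘ Fin.suc)            ≈⟨ *-distribˡ-sum (fromℕ 2) (f ∘ Fin.suc) ⟩
      sum (λ i → fromℕ 2 * f (Fin.suc i))    ≤⟨ geometric-bound 0≤b (λ i → begin
        fromℕ (2 ℕ.^ toℕ i) * (fromℕ 2 * f (Fin.suc i))
          ≈⟨ solve 3 (λ x y z → x :* (y :* z) := (y :* x) :* z) refl _ _ _ ⟩
        fromℕ 2 * fromℕ (2 ℕ.^ toℕ i) * f (Fin.suc i)
          ≈⟨ *-congʳ (fromℕ-* 2 (2 ℕ.^ toℕ i)) ⟨
        fromℕ (2 ℕ.^ suc (toℕ i)) * f (Fin.suc i)
          ≤⟨ f≤b (Fin.suc i) ⟩
        b ∎) ⟩
      fromℕ 2 * b ∎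

  -- The exponential series, logarithms and approximate ceilings.

  fromℕ-^ : ∀ m n → fromℕ (m ℕ.^ n) ≈ fromℕ m ^ n
  fromℕ-^ m zero    = +-identityʳ 1#
  fromℕ-^ m (suc n) = trans (fromℕ-* m (m ℕ.^ n)) (*-congˡ (fromℕ-^ m n))

  -- Both signs are carried along because multiplication by x may exchange them.
  ^-mono-∣∣ : ∀ {x a} → x ≤ a → - x ≤ a → ∀ n → x ^ n ≤ a ^ n × - (x ^ n) ≤ a ^ n
  ^-mono-∣∣ x≤a -x≤a zero = ≤-refl , 0≤y-x⇒x≤y
    (≤-trans (0≤fromℕ 2) (≤-reflexive (solve 0 (con (pos 2) := con (pos 1) :- (:- con (pos 1))) refl)))
  ^-mono-∣∣ {x} {a} x≤a -x≤a (suc n) = let (p , q) = ^-mono-∣∣ x≤a -x≤a n in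
    *-mono-∣∣ x≤a -x≤a p q ,
    ≤-trans (≤-reflexive (-‿distribʳ-* x (x ^ n)))
      (*-mono-∣∣ x≤a -x≤a q (≤-trans (≤-reflexive (⁻¹-involutive _)) p))

  -- (2k)^j ≤ j! (2k)^(2k) makes the j-th term of the exponential series at k
  -- at most (2k)^(2k) / 2^j.
  expPartialSum-bound : ∀ {x} k → x ≤ fromℕ k → - x ≤ fromℕ k → ∀ m →
    expPartialSum x m ≤ fromℕ (2 ℕ.^ suc (2 ℕ.* k ℕ.* (2 ℕ.* k)))
  expPartialSum-bound {x} k x≤k -x≤k m = begin
    expPartialSum x m                             ≤⟨ geometric-bound {m} (0≤fromℕ (K ℕ.^ K)) (term ∘ toℕ) ⟩
    fromℕ 2 * fromℕ (K ℕ.^ K)                     ≈⟨ fromℕ-* 2 (K ℕ.^ K) ⟨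
    fromℕ (2 ℕ.* K ℕ.^ K)                         ≤⟨ fromℕ-mono-≤ (ℕ.*-monoʳ-≤ 2 (m^m≤2^[m*m] K)) ⟩
    fromℕ (2 ℕ.^ suc (K ℕ.* K))                   ∎
    where
    open ≤-Reasoning
    K = 2 ℕ.* k
    term : ∀ j → fromℕ (2 ℕ.^ j) * (x ^ j * (1/ℕ (j !)) {{j ℕ.!≢0}}) ≤ fromℕ (K ℕ.^ K)
    term j = begin
      fromℕ (2 ℕ.^ j) * (x ^ j * 1/j!)
        ≈⟨ solve 3 (λ a b c → a :* (b :* c) := c :* (a :* b)) refl _ _ _ ⟩
      1/j! * (fromℕ (2 ℕ.^ j) * x ^ j)
        ≤⟨ *-monoˡ-≤ (0≤1/ℕ (j !) {{j ℕ.!≢0}}) (*-monoˡ-≤ (0≤fromℕ (2 ℕ.^ j)) (proj₁ (^-mono-∣∣ x≤k -x≤k j))) ⟩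
      1/j! * (fromℕ (2 ℕ.^ j) * fromℕ k ^ j)
        ≈⟨ *-congˡ (*-congˡ (fromℕ-^ k j)) ⟨
      1/j! * (fromℕ (2 ℕ.^ j) * fromℕ (k ℕ.^ j))
        ≈⟨ *-congˡ (fromℕ-* (2 ℕ.^ j) (k ℕ.^ j)) ⟨
      1/j! * fromℕ (2 ℕ.^ j ℕ.* k ℕ.^ j)
        ≡⟨ ≡.cong (λ a → 1/j! * fromℕ a) ([m*n]^o≡m^o*n^o 2 k j) ⟨
      1/j! * fromℕ (K ℕ.^ j)
        ≤⟨ *-monoˡ-≤ (0≤1/ℕ (j !) {{j ℕ.!≢0}}) (fromℕ-mono-≤ (m^j≤j!*m^m K j)) ⟩
      1/j! * fromℕ (j ! ℕ.* K ℕ.^ K)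
        ≈⟨ *-congˡ (fromℕ-* (j !) (K ℕ.^ K)) ⟩
      1/j! * (fromℕ (j !) * fromℕ (K ℕ.^ K))
        ≈⟨ solve 3 (λ a b c → c :* (a :* b) := a :* c :* b) refl _ _ _ ⟩
      fromℕ (j !) * 1/j! * fromℕ (K ℕ.^ K)
        ≈⟨ *-congʳ (*-1/ℕ (j !) {{j ℕ.!≢0}}) ⟩
      1# * fromℕ (K ℕ.^ K)
        ≈⟨ *-identityˡ _ ⟩
      fromℕ (K ℕ.^ K) ∎
      where
      1/j! = (1/ℕ (j !)) {{j ℕ.!≢0}}

  IsLog-lower-bound : ∀ {x ℓ} → IsLog x ℓ → ∀ k → ℓ ≤ fromℕ k → - ℓ ≤ fromℕ k →
    ∀ j → fromℕ (2 ℕ.^ j) < x → j ℕ.≤ suc (suc (2 ℕ.* k ℕ.* (2 ℕ.* k)))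
  IsLog-lower-bound {x} {ℓ} log k ℓ≤k -ℓ≤k j 2^j<x = ℕ.≮⇒≥ λ K<j → ℕ.<-irrefl ≡.refl (ℕ.<-≤-trans
    (fromℕ-cancel-< (<-≤-trans 2^j<x (begin
      x                                    ≈⟨ solve 2 (λ s x → x := s :+ (:- (s :- x))) refl s x ⟩
      -- One partial sum within distance 1 of x suffices; the error 1 is at most 2^(K + 1) and so
      -- costs a single doubling.
      s + - (s - x)                        ≤⟨ +-mono-≤ (expPartialSum-bound k ℓ≤k -ℓ≤k M) (≤-trans (-x≤∣x∣ _) (<⇒≤ (proj₂ limit M ℕ.≤-refl))) ⟩
      fromℕ (2 ℕ.^ suc K) + 1#             ≤⟨ +-mono-≤ ≤-refl (≤-trans (≤-reflexive (sym (+-identityʳ 1#))) (fromℕ-mono-≤ (ℕ.m^n>0 2 (suc K)))) ⟩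
      fromℕ (2 ℕ.^ suc K) + fromℕ (2 ℕ.^ suc K)
                                           ≈⟨ fromℕ-+ (2 ℕ.^ suc K) (2 ℕ.^ suc K) ⟨
      fromℕ (2 ℕ.^ suc K ℕ.+ 2 ℕ.^ suc K)  ≡⟨ ≡.cong (λ a → fromℕ (2 ℕ.^ suc K ℕ.+ a)) (ℕ.+-identityʳ (2 ℕ.^ suc K)) ⟨
      fromℕ (2 ℕ.^ suc (suc K))            ∎)))
    (ℕ.^-monoʳ-≤ 2 (ℕ.<⇒≤ K<j)))
    where
    open ≤-Reasoning
    K = 2 ℕ.* k ℕ.* (2 ℕ.* k)
    limit = log 1# 0<1
    M = proj₁ limit
    s = expPartialSum ℓ M

  -- The exact least index would require deciding x < g n. Cotransitivity decides only between g n <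
  -- x and x < g (n + 1), so the descent may stop one index late: x is known to exceed g two places
  -- below m, and nothing is claimed for m < 2.
  least-upper : (g : ℕ → Carrier) → (∀ n → g n < g (suc n)) → ∀ {x} n → x < g n →
    ∃[ m ] (x < g m × (∀ j → m ≡ suc (suc j) → g j < x))
  least-upper g g↑ zero          x<gn = zero , x<gn , λ _ ()
  least-upper g g↑ (suc zero)    x<gn = suc zero , x<gn , λ _ ()
  least-upper g g↑ {x} (suc (suc n)) x<gn =
    [ (λ gn<x → suc (suc n) , x<gn , λ { _ ≡.refl → gn<x })
    , least-upper g g↑ (suc n) ]′ (cotrans (g↑ n) x)

  ceiling : ∀ x → 0# ≤ x → ∃[ m ] (x < fromℕ m × fromℕ m ≤ x + fromℕ 2)
  ceiling x 0≤x = let (n , x<n) = archimedean x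
                      (m , x<m , low) = least-upper fromℕ n<1+n n x<n
                  in m , x<m , bound m low
    where
    open ≤-Reasoning
    small : ∀ {m} → m ℕ.≤ 2 → fromℕ m ≤ x + fromℕ 2
    small m≤2 = ≤-trans (fromℕ-mono-≤ m≤2) (≤-trans (≤-reflexive (sym (+-identityˡ _))) (+-monoˡ-≤ (fromℕ 2) 0≤x))
    bound : ∀ m → (∀ j → m ≡ suc (suc j) → fromℕ j < x) → fromℕ m ≤ x + fromℕ 2
    bound zero          low = small ℕ.z≤n
    bound (suc zero)    low = small (ℕ.s≤s ℕ.z≤n)
    bound (suc (suc m)) low = begin
      fromℕ (2 ℕ.+ m)     ≈⟨ fromℕ-+ 2 m ⟩
      fromℕ 2 + fromℕ m   ≈⟨ +-comm _ _ ⟩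
      fromℕ m + fromℕ 2   ≤⟨ +-monoˡ-≤ (fromℕ 2) (<⇒≤ (low m ≡.refl)) ⟩
      x + fromℕ 2         ∎

  log₂-ceiling : ∀ x → ∃[ m ] (x < fromℕ (2 ℕ.^ m) × (∀ j → m ≡ suc (suc j) → fromℕ (2 ℕ.^ j) < x))
  log₂-ceiling x = let (n , x<n) = archimedean x in
    least-upper (fromℕ ∘ (2 ℕ.^_)) (λ n → fromℕ-mono-< (ℕ.^-monoʳ-< 2 (ℕ.s≤s (ℕ.s≤s ℕ.z≤n)) (ℕ.n<1+n n)))
      n (<-≤-trans x<n (fromℕ-mono-≤ (ℕ.<⇒≤ (n<2^n n))))

module UniformityTester {c ℓ₁ ℓ₂} (R : RealNumbers c ℓ₁ ℓ₂) where
  open RealNumbers R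
  open Testing R
  open RealProperties R
  open CommutativeRing commutativeRing
    using ( refl; sym; trans; +-cong; +-congˡ; +-congʳ; *-cong; *-congˡ; *-congʳ
          ; -‿cong; *-comm; *-assoc; +-comm; *-identityˡ; *-identityʳ
          ; +-identityʳ; zeroʳ; reflexive )
  open Sum semiring using (sum; sum-cong-≋; ∑-distrib-+; *-distribˡ-sum; *-distribʳ-sum)
  open Solver using (solve; _:=_; _:+_; _:*_; _:-_; :-_; con)

  -- The decision tree.

  ½ : Carrier
  ½ = 1/ℕ 2

  pair : ∀ {n} → Fin n → Fin n → Subset n
  pair x y = ⁅ x ⁆ ∪ ⁅ y ⁆

  x∈pair : ∀ {n} (x y : Fin n) → x ∈ pair x y
  x∈pair x y = x∈p∪q⁺ (inj₁ (x∈⁅x⁆ x))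

  y∈pair : ∀ {n} (x y : Fin n) → y ∈ pair x y
  y∈pair x y = x∈p∪q⁺ {p = ⁅ x ⁆} (inj₂ (x∈⁅x⁆ y))

  ∈pair⁻ : ∀ {n} {x y z : Fin n} → z ∈ pair x y → z ≡ x ⊎ z ≡ y
  ∈pair⁻ {x = x} {y} z∈ = case x∈p∪q⁻ ⁅ x ⁆ ⁅ y ⁆ z∈ of λ where
    (inj₁ z∈x) → inj₁ (x∈⁅y⁆⇒x≡y x z∈x)
    (inj₂ z∈y) → inj₂ (x∈⁅y⁆⇒x≡y y z∈y)

  -- For x = y the oracle can only answer x, which would count as heads. The fair coin supplies the
  -- value 1/2 that f(x,x) · 2 μ(x) = μ(x) demands when μ(x) is positive.
  outcome : ∀ {n t} → (Bool → Algorithm n t) → Fin n → Fin n → Fin n → Algorithm n t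
  outcome next x y z with x Fin.≟ y
  ... | yes _ = toss 1 λ { Fin.zero → next true ; (Fin.suc _) → next false }
  ... | no  _ = next (does (z Fin.≟ x))

  -- The pair is queried even if x = y, since the index of `Algorithm` counts the queries exactly on
  -- every branch. These two queries are what one step of `T * 2` in `bet` unfolds to.
  round : ∀ {n t} → (Bool → Algorithm (suc n) t) → Algorithm (suc n) (suc (suc t))
  round {n} next =
    query ⊤ (Fin.zero , ∈⊤) λ x → toss n λ y → query (pair x y) (x , x∈pair x y) (outcome next x y)

  factor : ℕ → Bool → ℕ
  factor w true  = 3 ℕ.+ w
  factor w false = 1 ℕ.+ w

  -- Relative to 2 + w, the capital a is multiplied by 1 ± 1/(2 + w).
  bet : ∀ {n} (w C : ℕ) T → ℕ → Algorithm (suc n) (T ℕ.* 2)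
  bet w C zero    a = output (a ℕ.<ᵇ C)
  bet w C (suc T) a = round λ b → bet w C T (a ℕ.* factor w b)

  -- Expectations and the measure of a pair.

  module _ {n} (μ : Distribution n) where

    mass≤1 : ∀ i → mass μ i ≤ 1#
    mass≤1 i = ≤-trans (term≤sum (mass-≥0 μ) i) (≤-reflexive (mass-sum μ))

    expectation-affine : ∀ a b (f : Fin n → Carrier) →
      ∑[ i < n ] (mass μ i * (a + b * f i)) ≈ a + b * (∑[ i < n ] (mass μ i * f i))
    expectation-affine a b f = begin-equality
      ∑[ i < n ] (mass μ i * (a + b * f i))
        ≈⟨ sum-cong-≋ (λ i → solve 4 (λ m a b f → m :* (a :+ b :* f) := a :* m :+ b :* (m :* f)) refl (mass μ i) a b (f i)) ⟩
      ∑[ i < n ] (a * mass μ i + b * (mass μ i * f i))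
        ≈⟨ sum-linear a b (mass μ) (λ i → mass μ i * f i) ⟩
      a * sum (mass μ) + b * (∑[ i < n ] (mass μ i * f i))
        ≈⟨ +-congʳ (trans (*-congˡ (mass-sum μ)) (*-identityʳ a)) ⟩
      a + b * (∑[ i < n ] (mass μ i * f i)) ∎
      where open ≤-Reasoning

    measure-⊤ : measure μ ⊤ ≈ 1#
    measure-⊤ = trans
      (sum-cong-≋ λ i → reflexive (≡.cong (if_then mass μ i else 0#) (dec-true (i ∈? ⊤) ∈⊤)))
      (mass-sum μ)

    measure-pair : ∀ {x y} → ¬ (x ≡ y) → measure μ (pair x y) ≈ mass μ x + mass μ y
    measure-pair {x} {y} x≢y = begin-equality
      measure μ (pair x y)
        ≈⟨ sum-cong-≋ pointwise ⟩
      ∑[ i < n ] (at x i + at y i)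
        ≈⟨ ∑-distrib-+ (at x) (at y) ⟩
      sum (at x) + sum (at y)
        ≈⟨ +-cong (sum-indicator (mass μ) x) (sum-indicator (mass μ) y) ⟩
      mass μ x + mass μ y ∎
      where
      open ≤-Reasoning
      at : Fin n → Fin n → Carrier
      at j i = if does (i Fin.≟ j) then mass μ i else 0#
      pointwise : ∀ i → (if does (i ∈? pair x y) then mass μ i else 0#) ≈ at x i + at y i
      pointwise i with i Fin.≟ x | i Fin.≟ y
      ... | yes ≡.refl | yes ≡.refl = ⊥-elim (x≢y ≡.refl)
      ... | yes ≡.refl | no _ = trans
        (reflexive (≡.cong (if_then mass μ i else 0#) (dec-true (i ∈? pair x y) (x∈pair x y))))
        (sym (+-identityʳ _))
      ... | no _ | yes ≡.refl = trans
        (reflexive (≡.cong (if_then mass μ i else 0#) (dec-true (i ∈? pair x y) (y∈pair x y))))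
        (sym (+-identityˡ _))
      ... | no i≢x | no i≢y = trans
        (reflexive (≡.cong (if_then mass μ i else 0#)
          (dec-false (i ∈? pair x y) λ i∈ → [ i≢x , i≢y ]′ (∈pair⁻ i∈))))
        (sym (+-identityʳ _))

  uniform : ∀ n .{{_ : NonZero n}} → Distribution n
  uniform n = record
    { mass     = λ _ → 1/ℕ n
    ; mass-≥0  = λ _ → 0≤1/ℕ n
    ; mass-sum = trans (sum-const n (1/ℕ n)) (*-1/ℕ n)
    }

  -- One round as a single toss of a biased coin.

  module _ {n} {μ : Distribution (suc n)} (O : ConditionalOracle μ) where
    open ConditionalOracle O
    open ≤-Reasoning

    heads|xy : Fin (suc n) → Fin (suc n) → Carrier
    heads|xy x y with x Fin.≟ y
    ... | yes _ = ½
    ... | no  _ = mass (law (pair x y) (x , x∈pair x y)) x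

    average : (Fin (suc n) → Carrier) → Carrier
    average f = 1/ℕ suc n * sum f

    average-affine : ∀ a b f → average (λ y → a + b * f y) ≈ a + b * average f
    average-affine a b f = begin-equality
      average (λ y → a + b * f y)
        ≈⟨ *-congˡ (trans (∑-distrib-+ (λ _ → a) (λ y → b * f y))
             (+-cong (sum-const (suc n) a) (sym (*-distribˡ-sum b f)))) ⟩
      1/ℕ suc n * (fromℕ (suc n) * a + b * sum f)
        ≈⟨ solve 5 (λ r k a b s → r :* (k :* a :+ b :* s) := k :* r :* a :+ b :* (r :* s)) refl
             (1/ℕ suc n) (fromℕ (suc n)) a b (sum f) ⟩
      fromℕ (suc n) * 1/ℕ suc n * a + b * average f
        ≈⟨ +-congʳ (trans (*-congʳ (*-1/ℕ (suc n))) (*-identityˡ a)) ⟩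
      a + b * average f ∎

    ν : Distribution (suc n)
    ν = law ⊤ (Fin.zero , ∈⊤)

    mean : (Fin (suc n) → Fin (suc n) → Carrier) → Carrier
    mean F = ∑[ x < suc n ] (mass ν x * average (F x))

    mean-cong : ∀ {F G} → (∀ x y → F x y ≈ G x y) → mean F ≈ mean G
    mean-cong F≈G = sum-cong-≋ λ x → *-congˡ {mass ν x} (*-congˡ {1/ℕ suc n} (sum-cong-≋ (F≈G x)))

    mean-affine : ∀ a b F → mean (λ x y → a + b * F x y) ≈ a + b * mean F
    mean-affine a b F = trans (sum-cong-≋ λ x → *-congˡ {mass ν x} (average-affine a b (F x)))
      (expectation-affine ν a b (λ x → average (F x)))

    mean-nonneg : ∀ {F} → (∀ x y → 0# ≤ F x y) → 0# ≤ mean F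
    mean-nonneg 0≤F = sum-nonneg λ x →
      0≤-* (mass-≥0 ν x) (0≤-* (0≤1/ℕ (suc n)) (sum-nonneg (0≤F x)))

    heads : Carrier
    heads = mean heads|xy

    ν≈μ : ∀ x → mass ν x ≈ mass μ x
    ν≈μ x = begin-equality
      mass ν x                              ≈⟨ law-pos ⊤ _ x ∈⊤ 0<⊤ ⟩
      mass μ x * recip (measure μ ⊤) 0<⊤    ≈⟨ *-congˡ recip≈1 ⟩
      mass μ x * 1#                         ≈⟨ *-identityʳ _ ⟩
      mass μ x                              ∎
      where
      0<⊤ : 0# < measure μ ⊤
      0<⊤ = <-respʳ-≈ (sym (measure-⊤ μ)) 0<1
      recip≈1 : recip (measure μ ⊤) 0<⊤ ≈ 1#
      recip≈1 = trans (sym (*-identityˡ _)) (trans (*-congʳ (sym (measure-⊤ μ))) (*-recip _ 0<⊤))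

    -- The continuation sees only one bit, so the probability is affine in the chance of heads, with
    -- coefficients independent of x and y.
    Pr-outcome : ∀ {t} b (next : Bool → Algorithm (suc n) t) x y →
      Pr O b (query (pair x y) (x , x∈pair x y) (outcome next x y))
        ≈ Pr O b (next false) + (Pr O b (next true) - Pr O b (next false)) * heads|xy x y
    Pr-outcome b next x y with x Fin.≟ y
    ... | yes _ = begin-equality
      ∑[ z < suc n ] (mass λxy z * (½ * (P + (Q + 0#))))
        ≈⟨ *-distribʳ-sum (½ * (P + (Q + 0#))) (mass λxy) ⟨
      sum (mass λxy) * (½ * (P + (Q + 0#)))
        ≈⟨ trans (*-congʳ (mass-sum λxy)) (*-identityˡ _) ⟩
      ½ * (P + (Q + 0#))
        ≈⟨ solve 3 (λ h p q → h :* (p :+ (q :+ con (pos 0))) := con (pos 2) :* h :* q :+ (p :- q) :* h) refl ½ P Q ⟩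
      fromℕ 2 * ½ * Q + (P - Q) * ½
        ≈⟨ +-congʳ (trans (*-congʳ (*-1/ℕ 2)) (*-identityˡ Q)) ⟩
      Q + (P - Q) * ½ ∎
      where
      λxy = law (pair x y) (x , x∈pair x y)
      P = Pr O b (next true)
      Q = Pr O b (next false)
    ... | no _ = begin-equality
      ∑[ z < suc n ] (mass λxy z * Pr O b (next (does (z Fin.≟ x))))
        ≈⟨ sum-cong-≋ pointwise ⟩
      ∑[ z < suc n ] (Q * mass λxy z + (P - Q) * at z)
        ≈⟨ sum-linear Q (P - Q) (mass λxy) at ⟩
      Q * sum (mass λxy) + (P - Q) * sum at
        ≈⟨ +-cong (trans (*-congˡ (mass-sum λxy)) (*-identityʳ Q)) (*-congˡ (sum-indicator (mass λxy) x)) ⟩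
      Q + (P - Q) * mass λxy x ∎
      where
      λxy = law (pair x y) (x , x∈pair x y)
      P = Pr O b (next true)
      Q = Pr O b (next false)
      at : Fin (suc n) → Carrier
      at z = if does (z Fin.≟ x) then mass λxy z else 0#
      pointwise : ∀ z → mass λxy z * Pr O b (next (does (z Fin.≟ x))) ≈ Q * mass λxy z + (P - Q) * at z
      pointwise z with does (z Fin.≟ x)
      ... | true  = solve 3 (λ m p q → m :* p := q :* m :+ (p :- q) :* m) refl (mass λxy z) P Q
      ... | false = solve 3 (λ m p q → m :* q := q :* m :+ (p :- q) :* con (pos 0)) refl (mass λxy z) P Q

    -- Averaging over x and y is affine as well. Hence the oracle influences a round only through
    -- the number `heads`.
    Pr-round : ∀ {t} b (next : Bool → Algorithm (suc n) t) →
      Pr O b (round next) ≈ Pr O b (next false) + (Pr O b (next true) - Pr O b (next false)) * heads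
    Pr-round b next = trans (mean-cong (Pr-outcome b next)) (mean-affine _ _ heads|xy)

    Pr-total : ∀ {t} (A : Algorithm (suc n) t) → Pr O true A + Pr O false A ≈ 1#
    Pr-total (output true)  = +-identityʳ 1#
    Pr-total (output false) = +-identityˡ 1#
    Pr-total (toss k next) = begin-equality
      1/ℕ suc k * sum f + 1/ℕ suc k * sum g
        ≈⟨ solve 3 (λ r a b → r :* a :+ r :* b := r :* (a :+ b)) refl (1/ℕ suc k) (sum f) (sum g) ⟩
      1/ℕ suc k * (sum f + sum g)
        ≈⟨ *-congˡ (trans (sym (∑-distrib-+ f g)) (trans (sum-cong-≋ (Pr-total ∘ next)) (sum-const (suc k) 1#))) ⟩
      1/ℕ suc k * (fromℕ (suc k) * 1#)
        ≈⟨ solve 2 (λ r k → r :* (k :* con (pos 1)) := k :* r) refl (1/ℕ suc k) (fromℕ (suc k)) ⟩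
      fromℕ (suc k) * 1/ℕ suc k
        ≈⟨ *-1/ℕ (suc k) ⟩
      1# ∎
      where
      f g : Fin (suc k) → Carrier
      f i = Pr O true (next i)
      g i = Pr O false (next i)
    Pr-total (query A ne next) = begin-equality
      sum (λ j → m j * f j) + sum (λ j → m j * g j)
        ≈⟨ ∑-distrib-+ (λ j → m j * f j) (λ j → m j * g j) ⟨
      sum (λ j → m j * f j + m j * g j)
        ≈⟨ sum-cong-≋ (λ j → trans
             (solve 3 (λ m f g → m :* f :+ m :* g := m :* (f :+ g)) refl (m j) (f j) (g j))
             (trans (*-congˡ (Pr-total (next j))) (*-identityʳ (m j)))) ⟩
      sum m
        ≈⟨ mass-sum (law A ne) ⟩
      1# ∎
      where
      m f g : Fin (suc n) → Carrier
      m = mass (law A ne)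
      f j = Pr O true (next j)
      g j = Pr O false (next j)

    0≤Pr : ∀ {t} b (A : Algorithm (suc n) t) → 0# ≤ Pr O b A
    0≤Pr true  (output true)  = <⇒≤ 0<1
    0≤Pr false (output true)  = ≤-refl
    0≤Pr true  (output false) = ≤-refl
    0≤Pr false (output false) = <⇒≤ 0<1
    0≤Pr b (toss k next)      = 0≤-* (0≤1/ℕ (suc k)) (sum-nonneg λ i → 0≤Pr b (next i))
    0≤Pr b (query A ne next)  = sum-nonneg λ j → 0≤-* (mass-≥0 (law A ne) j) (0≤Pr b (next j))

    ½≤1 : ½ ≤ 1#
    ½≤1 = begin
      ½              ≈⟨ +-identityʳ ½ ⟨
      ½ + 0#         ≤⟨ +-mono-≤ ≤-refl (0≤1/ℕ 2) ⟩
      ½ + ½          ≈⟨ solve 1 (λ h → h :+ h := con (pos 2) :* h) refl ½ ⟩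
      fromℕ 2 * ½    ≈⟨ *-1/ℕ 2 ⟩
      1#             ∎

    0≤heads|xy : ∀ x y → 0# ≤ heads|xy x y
    0≤heads|xy x y with x Fin.≟ y
    ... | yes _ = 0≤1/ℕ 2
    ... | no  _ = mass-≥0 (law (pair x y) _) x

    heads|xy≤1 : ∀ x y → heads|xy x y ≤ 1#
    heads|xy≤1 x y with x Fin.≟ y
    ... | yes _ = ½≤1
    ... | no  _ = mass≤1 (law (pair x y) _) x

    0≤heads : 0# ≤ heads
    0≤heads = mean-nonneg 0≤heads|xy

    heads≤1 : heads ≤ 1#
    heads≤1 = 0≤y-x⇒x≤y (begin
      0#
        ≤⟨ mean-nonneg (λ x y → ≤-trans (x≤y⇒0≤y-x (heads|xy≤1 x y)) (≤-reflexive (expand (heads|xy x y)))) ⟩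
      mean (λ x y → 1# + - 1# * heads|xy x y)
        ≈⟨ mean-affine 1# (- 1#) heads|xy ⟩
      1# + - 1# * heads
        ≈⟨ expand heads ⟨
      1# - heads ∎)
      where
      expand : ∀ x → 1# - x ≈ 1# + - 1# * x
      expand = solve 1 (λ x → con (pos 1) :- x := con (pos 1) :+ (:- con (pos 1)) :* x) refl

    -- The bias of the coin for uniform and for far distributions.

    heads|xy-balance : ∀ x y → heads|xy x y * (mass μ x + mass μ y) ≈ mass μ x
    heads|xy-balance x y with x Fin.≟ y
    ... | yes ≡.refl = begin-equality
      ½ * (mass μ x + mass μ x)  ≈⟨ solve 2 (λ h m → h :* (m :+ m) := con (pos 2) :* h :* m) refl ½ (mass μ x) ⟩
      fromℕ 2 * ½ * mass μ x     ≈⟨ trans (*-congʳ (*-1/ℕ 2)) (*-identityˡ _) ⟩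
      mass μ x                   ∎
    ... | no x≢y = ≈-by-cases (0# < measure μ A)
      (λ 0<A → begin-equality
        mass (law A _) x * (mass μ x + mass μ y)
          ≈⟨ *-cong (law-pos A _ x (x∈pair x y) 0<A) (sym (measure-pair μ x≢y)) ⟩
        mass μ x * recip (measure μ A) 0<A * measure μ A
          ≈⟨ solve 3 (λ m r a → m :* r :* a := m :* (a :* r)) refl _ _ _ ⟩
        mass μ x * (measure μ A * recip (measure μ A) 0<A)
          ≈⟨ trans (*-congˡ (*-recip _ 0<A)) (*-identityʳ _) ⟩
        mass μ x ∎)
      -- On a pair of mass zero both masses vanish, and so do both sides.
      λ A≤0 →
        let s≤0 : mass μ x + mass μ y ≤ 0#
            s≤0 = ≤-trans (≤-reflexive (sym (measure-pair μ x≢y))) A≤0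
            x≤s : mass μ x ≤ mass μ x + mass μ y
            x≤s = ≤-trans (≤-reflexive (sym (+-identityʳ _))) (+-mono-≤ ≤-refl (mass-≥0 μ y))
            x≈0 : mass μ x ≈ 0#
            x≈0 = ≤-antisym (≤-trans x≤s s≤0) (mass-≥0 μ x)
            s≈0 : mass μ x + mass μ y ≈ 0#
            s≈0 = ≤-antisym s≤0 (≤-trans (mass-≥0 μ x) x≤s)
        in trans (*-congˡ s≈0) (trans (zeroʳ _) (sym x≈0))
      where A = pair x y

    heads-uniform : IsUniform (suc n) μ → heads ≈ ½
    heads-uniform μ≈U = begin-equality
      heads                                   ≈⟨ mean-cong fair ⟩
      mean (λ x y → ½ + 0# * heads|xy x y)    ≈⟨ mean-affine ½ 0# heads|xy ⟩
      ½ + 0# * heads                          ≈⟨ solve 2 (λ h q → h :+ con (pos 0) :* q := h) refl ½ heads ⟩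
      ½                                       ∎
      where
      k = fromℕ (suc n)
      u = 1/ℕ suc n
      -- The constant 1/2 is written as an affine function of `heads|xy` so that `mean-affine`
      -- computes its mean.
      fair : ∀ x y → heads|xy x y ≈ ½ + 0# * heads|xy x y
      fair x y = trans (*-cancelˡ-≈ (0<fromℕ-suc 1) (begin-equality
        fromℕ 2 * f                        ≈⟨ solve 1 (λ f → con (pos 2) :* f := con (pos 2) :* f :* con (pos 1)) refl f ⟩
        fromℕ 2 * f * 1#                   ≈⟨ *-congˡ (*-1/ℕ (suc n)) ⟨
        fromℕ 2 * f * (k * u)              ≈⟨ solve 3 (λ f k u → con (pos 2) :* f :* (k :* u) := k :* (f :* (u :+ u))) refl f k u ⟩
        k * (f * (u + u))                  ≈⟨ *-congˡ (*-congˡ (+-cong (μ≈U x) (μ≈U y))) ⟨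
        k * (f * (mass μ x + mass μ y))    ≈⟨ *-congˡ (trans (heads|xy-balance x y) (μ≈U x)) ⟩
        k * u                              ≈⟨ *-1/ℕ (suc n) ⟩
        1#                                 ≈⟨ *-1/ℕ 2 ⟨
        fromℕ 2 * ½                        ∎))
        (solve 2 (λ h f → h := h :+ con (pos 0) :* f) refl ½ f)
        where f = heads|xy x y

    -- The square whose nonnegativity is used is (μ(x) + μ(y)) (2f − 1 − τ)², where
    -- f (μ(x) + μ(y)) = μ(x).
    heads|xy-bound : ∀ τ x y →
      mass μ x * (fromℕ 4 * (1# + τ) - (1# + τ) * (1# + τ)) + - ((1# + τ) * (1# + τ)) * mass μ y
        ≤ fromℕ 4 * mass μ x * heads|xy x y
    heads|xy-bound τ x y = 0≤y-x⇒x≤y (begin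
      0#
        ≤⟨ 0≤-* (≤-trans (≤-reflexive (sym (+-identityʳ 0#))) (+-mono-≤ (mass-≥0 μ x) (mass-≥0 μ y)))
             (0≤x² (fromℕ 2 * f - (1# + τ))) ⟩
      (a + a′) * ((fromℕ 2 * f - (1# + τ)) * (fromℕ 2 * f - (1# + τ)))
        ≈⟨ solve 4 (λ a a′ f t →
             (a :+ a′) :* ((con (pos 2) :* f :- t) :* (con (pos 2) :* f :- t))
               := (con (pos 4) :* f :- con (pos 4) :* t) :* (f :* (a :+ a′)) :+ t :* t :* (a :+ a′))
             refl a a′ f (1# + τ) ⟩
      (fromℕ 4 * f - fromℕ 4 * (1# + τ)) * (f * (a + a′)) + (1# + τ) * (1# + τ) * (a + a′)
        ≈⟨ +-congʳ (*-congˡ (heads|xy-balance x y)) ⟩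
      (fromℕ 4 * f - fromℕ 4 * (1# + τ)) * a + (1# + τ) * (1# + τ) * (a + a′)
        ≈⟨ solve 4 (λ a a′ f t →
             (con (pos 4) :* f :- con (pos 4) :* t) :* a :+ t :* t :* (a :+ a′)
               := con (pos 4) :* a :* f :- (a :* (con (pos 4) :* t :- t :* t) :+ (:- (t :* t)) :* a′))
             refl a a′ f (1# + τ) ⟩
      fromℕ 4 * a * f - (a * (fromℕ 4 * (1# + τ) - (1# + τ) * (1# + τ)) + - ((1# + τ) * (1# + τ)) * a′) ∎)
      where
      a  = mass μ x
      a′ = mass μ y
      f  = heads|xy x y

    -- With s = μ(x) + μ(y) and f s = μ(x), one has (μ(x) - μ(y))² / s = s (2f - 1)² = 4 μ(x) f - 3
    -- μ(x) + μ(y), read as 0 if s = 0. So this is the sum over y of (μ(x) - μ(y))² / s + e s. Here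
    -- e stands for τ²: both signs of τ share this upper bound.
    excess : Carrier → Fin (suc n) → Carrier
    excess e x = (fromℕ 4 * (mass μ x * sum (heads|xy x)) + (e - fromℕ 3) * fromℕ (suc n) * mass μ x) + (1# + e)

    -- The pairwise inequality is summed over y; the differences μ(x) - μ(y) add up to (n + 1) μ(x)
    -- - 1, which is n + 1 times the deviation from uniform.
    excess-bound : ∀ τ x →
      fromℕ 2 * τ * fromℕ (suc n) * (mass μ x - 1/ℕ suc n) ≤ excess (τ * τ) x
    excess-bound τ x = 0≤y-x⇒x≤y (begin
      0#
        ≤⟨ x≤y⇒0≤y-x (sum-mono-≤ (heads|xy-bound τ x)) ⟩
      sum (λ y → fromℕ 4 * a * heads|xy x y) - sum (λ y → α + β * mass μ y)
        ≈⟨ +-cong (sym (*-distribˡ-sum (fromℕ 4 * a) (heads|xy x))) (-‿cong (trans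
             (∑-distrib-+ (λ _ → α) (λ y → β * mass μ y))
             (+-cong (sum-const (suc n) α) (trans (sym (*-distribˡ-sum β (mass μ))) (*-congˡ (mass-sum μ)))))) ⟩
      fromℕ 4 * a * S - (k * α + β * 1#)
        ≈⟨ solve 4 (λ a S k τ →
             con (pos 4) :* a :* S :- (k :* (a :* (con (pos 4) :* (con (pos 1) :+ τ) :- (con (pos 1) :+ τ) :* (con (pos 1) :+ τ)))
                 :+ (:- ((con (pos 1) :+ τ) :* (con (pos 1) :+ τ))) :* con (pos 1))
               := (con (pos 4) :* (a :* S) :+ (τ :* τ :- con (pos 3)) :* k :* a) :+ (con (pos 1) :+ τ :* τ)
                    :- (con (pos 2) :* τ :* k :* a :- con (pos 2) :* τ :* con (pos 1)))
             refl a S k τ ⟩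
      excess (τ * τ) x - (fromℕ 2 * τ * k * a - fromℕ 2 * τ * 1#)
        ≈⟨ +-congˡ (-‿cong (+-congˡ (-‿cong (*-congˡ (*-1/ℕ (suc n)))))) ⟨
      excess (τ * τ) x - (fromℕ 2 * τ * k * a - fromℕ 2 * τ * (k * u))
        ≈⟨ +-congˡ (-‿cong (solve 4 (λ τ k a u →
             con (pos 2) :* τ :* k :* a :- con (pos 2) :* τ :* (k :* u) := con (pos 2) :* τ :* k :* (a :- u))
             refl τ k a u)) ⟩
      excess (τ * τ) x - fromℕ 2 * τ * k * (a - u) ∎)
      where
      a = mass μ x
      k = fromℕ (suc n)
      u = 1/ℕ suc n
      S = sum (heads|xy x)
      α = a * (fromℕ 4 * (1# + τ) - (1# + τ) * (1# + τ))
      β = - ((1# + τ) * (1# + τ))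

    heads-via-μ : fromℕ (suc n) * heads ≈ ∑[ x < suc n ] (mass μ x * sum (heads|xy x))
    heads-via-μ = begin-equality
      k * heads
        ≈⟨ *-congˡ (sum-cong-≋ λ x → trans (*-congʳ (ν≈μ x))
             (solve 3 (λ a u s → a :* (u :* s) := u :* (a :* s)) refl (mass μ x) u (sum (heads|xy x)))) ⟩
      k * sum (λ x → u * (mass μ x * sum (heads|xy x)))
        ≈⟨ *-congˡ (*-distribˡ-sum u (λ x → mass μ x * sum (heads|xy x))) ⟨
      k * (u * G)
        ≈⟨ *-assoc k u G ⟨
      k * u * G
        ≈⟨ trans (*-congʳ (*-1/ℕ (suc n))) (*-identityˡ G) ⟩
      G ∎
      where
      k = fromℕ (suc n)
      u = 1/ℕ suc n
      G = ∑[ x < suc n ] (mass μ x * sum (heads|xy x))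

    -- With k = n + 1 the number of points, summing the excess over x gives 2k (2q - 1) + 2k ε²,
    -- while the deviations contribute at least 2εk · 2ε; the difference is 2q - 1 ≥ ε². The size ε
    -- of τ is the one maximising 4ετ - 2τ².
    heads-far : ∀ {ε} → 0# ≤ ε → Far ε (IsUniform (suc n)) μ → 1# + ε * ε ≤ fromℕ 2 * heads
    heads-far {ε} 0≤ε far = *-cancelˡ-≤ (0<fromℕ-suc 1) (*-cancelˡ-≤ (0<fromℕ-suc n) (0≤y-x⇒x≤y (begin
      0#
        ≤⟨ x≤y⇒0≤y-x (begin
             fromℕ 2 * ε * k * (fromℕ 2 * ε)
               ≤⟨ *-monoˡ-≤ 0≤z 2ε≤D ⟩
             fromℕ 2 * ε * k * sum D
               ≈⟨ *-distribˡ-sum (fromℕ 2 * ε * k) D ⟩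
             sum (λ x → fromℕ 2 * ε * k * D x)
               -- Here τ is ε or -ε according to the sign of μ(x) - 1/k.
               ≤⟨ sum-mono-≤ (λ x → *∣x∣≤ 0≤z (excess-bound ε x) (excess-bound⁻ x)) ⟩
             sum (excess e)
               ≈⟨ sum-excess ⟩
             (fromℕ 4 * (k * heads) + (e - fromℕ 3) * k * 1#) + k * (1# + e) ∎) ⟩
      (fromℕ 4 * (k * heads) + (e - fromℕ 3) * k * 1#) + k * (1# + e) - fromℕ 2 * ε * k * (fromℕ 2 * ε)
        ≈⟨ solve 3 (λ k h ε →
             (con (pos 4) :* (k :* h) :+ (ε :* ε :- con (pos 3)) :* k :* con (pos 1)) :+ k :* (con (pos 1) :+ ε :* ε)
                 :- con (pos 2) :* ε :* k :* (con (pos 2) :* ε)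
               := k :* (con (pos 2) :* (con (pos 2) :* h)) :- k :* (con (pos 2) :* (con (pos 1) :+ ε :* ε)))
             refl k heads ε ⟩
      k * (fromℕ 2 * (fromℕ 2 * heads)) - k * (fromℕ 2 * (1# + e)) ∎)))
      where
      k = fromℕ (suc n)
      u = 1/ℕ suc n
      e = ε * ε
      D : Fin (suc n) → Carrier
      D x = ∣ mass μ x - u ∣ᴿ
      0≤z : 0# ≤ fromℕ 2 * ε * k
      0≤z = 0≤-* (0≤-* (0≤fromℕ 2) 0≤ε) (0≤fromℕ (suc n))
      2ε≤D : fromℕ 2 * ε ≤ sum D
      2ε≤D = begin
        fromℕ 2 * ε              ≤⟨ *-monoˡ-≤ (0≤fromℕ 2) (far (uniform (suc n)) (λ _ → refl)) ⟩
        fromℕ 2 * (½ * sum D)    ≈⟨ *-assoc _ _ _ ⟨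
        fromℕ 2 * ½ * sum D      ≈⟨ trans (*-congʳ (*-1/ℕ 2)) (*-identityˡ _) ⟩
        sum D                    ∎
      excess-bound⁻ : ∀ x → fromℕ 2 * ε * k * - (mass μ x - u) ≤ excess e x
      excess-bound⁻ x = begin
        fromℕ 2 * ε * k * - (mass μ x - u)
          ≈⟨ solve 3 (λ ε k d → con (pos 2) :* ε :* k :* (:- d) := con (pos 2) :* (:- ε) :* k :* d) refl ε k (mass μ x - u) ⟩
        fromℕ 2 * - ε * k * (mass μ x - u)
          ≤⟨ excess-bound (- ε) x ⟩
        excess (- ε * - ε) x
          ≈⟨ +-cong (+-congˡ (*-congʳ (*-congʳ (+-congʳ sq)))) (+-congˡ sq) ⟩
        excess e x ∎
        where
        sq : - ε * - ε ≈ e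
        sq = solve 1 (λ ε → (:- ε) :* (:- ε) := ε :* ε) refl ε
      sum-excess : sum (excess e) ≈ (fromℕ 4 * (k * heads) + (e - fromℕ 3) * k * 1#) + k * (1# + e)
      sum-excess = begin-equality
        sum (excess e)
          ≈⟨ ∑-distrib-+ (λ x → fromℕ 4 * (mass μ x * sum (heads|xy x)) + (e - fromℕ 3) * k * mass μ x) (λ _ → 1# + e) ⟩
        sum (λ x → fromℕ 4 * (mass μ x * sum (heads|xy x)) + (e - fromℕ 3) * k * mass μ x) + sum {suc n} (λ _ → 1# + e)
          ≈⟨ +-cong (sum-linear (fromℕ 4) ((e - fromℕ 3) * k) (λ x → mass μ x * sum (heads|xy x)) (mass μ)) (sum-const (suc n) (1# + e)) ⟩
        (fromℕ 4 * (∑[ x < suc n ] (mass μ x * sum (heads|xy x))) + (e - fromℕ 3) * k * sum (mass μ)) + k * (1# + e)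
          ≈⟨ +-congʳ (+-cong (*-congˡ (sym heads-via-μ)) (*-congˡ (mass-sum μ))) ⟩
        (fromℕ 4 * (k * heads) + (e - fromℕ 3) * k * 1#) + k * (1# + e) ∎

    -- Evolution of the capital.

    module _ (w C : ℕ) where

      -- If the coin is fair, the capital relative to (2 + w)^T is a martingale.
      fair-rejection : heads ≈ ½ → ∀ T a →
        fromℕ C * Pr O false (bet w C T a) ≤ fromℕ (a ℕ.* (2 ℕ.+ w) ℕ.^ T)
      -- Markov's inequality sits in the base case: C times the indicator of rejection, that is of C
      -- ≤ a, is at most a.
      fair-rejection h≈½ zero a with a ℕ.<ᵇ C | ℕ.<ᵇ-reflects-< a C
      ... | true  | ofʸ a<C = ≤-trans (≤-reflexive (zeroʳ (fromℕ C))) (0≤fromℕ (a ℕ.* 1))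
      ... | false | ofⁿ a≮C = begin
        fromℕ C * 1#      ≈⟨ *-identityʳ _ ⟩
        fromℕ C           ≤⟨ fromℕ-mono-≤ (ℕ.≤-trans (ℕ.≮⇒≥ a≮C) (ℕ.≤-reflexive (≡.sym (ℕ.*-identityʳ a)))) ⟩
        fromℕ (a ℕ.* 1)   ∎
      fair-rejection h≈½ (suc T) a = *-cancelˡ-≤ (0<fromℕ-suc 1) (begin
        fromℕ 2 * (fromℕ C * Pr O false (bet w C (suc T) a))
          ≈⟨ *-congˡ (*-congˡ (trans (Pr-round false next) (+-congˡ (*-congˡ h≈½)))) ⟩
        fromℕ 2 * (fromℕ C * (Q + (P - Q) * ½))
          ≈⟨ solve 4 (λ c p q h → con (pos 2) :* (c :* (q :+ (p :- q) :* h))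
               := con (pos 2) :* (c :* q) :+ (c :* p :- c :* q) :* (con (pos 2) :* h)) refl (fromℕ C) P Q ½ ⟩
        fromℕ 2 * (fromℕ C * Q) + (fromℕ C * P - fromℕ C * Q) * (fromℕ 2 * ½)
          ≈⟨ +-congˡ (*-congˡ (*-1/ℕ 2)) ⟩
        fromℕ 2 * (fromℕ C * Q) + (fromℕ C * P - fromℕ C * Q) * 1#
          ≈⟨ solve 2 (λ p q → con (pos 2) :* q :+ (p :- q) :* con (pos 1) := p :+ q) refl _ _ ⟩
        fromℕ C * P + fromℕ C * Q
          ≤⟨ +-mono-≤ (fair-rejection h≈½ T _) (fair-rejection h≈½ T _) ⟩
        fromℕ (a ℕ.* (3 ℕ.+ w) ℕ.* (2 ℕ.+ w) ℕ.^ T) + fromℕ (a ℕ.* (1 ℕ.+ w) ℕ.* (2 ℕ.+ w) ℕ.^ T)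
          ≈⟨ fromℕ-+ (a ℕ.* (3 ℕ.+ w) ℕ.* (2 ℕ.+ w) ℕ.^ T) _ ⟨
        fromℕ (a ℕ.* (3 ℕ.+ w) ℕ.* (2 ℕ.+ w) ℕ.^ T ℕ.+ a ℕ.* (1 ℕ.+ w) ℕ.* (2 ℕ.+ w) ℕ.^ T)
          ≡⟨ ≡.cong fromℕ (step-average a w ((2 ℕ.+ w) ℕ.^ T)) ⟩
        fromℕ (2 ℕ.* (a ℕ.* (2 ℕ.+ w) ℕ.^ suc T))
          ≈⟨ fromℕ-* 2 (a ℕ.* (2 ℕ.+ w) ℕ.^ suc T) ⟩
        fromℕ 2 * fromℕ (a ℕ.* (2 ℕ.+ w) ℕ.^ suc T) ∎)
        where
        next : Bool → Algorithm (suc n) (T ℕ.* 2)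
        next b = bet w C T (a ℕ.* factor w b)
        P = Pr O false (next true)
        Q = Pr O false (next false)

      -- If 2 (2 + w) q ≥ 4 + w, the inverse of the capital relative to (2 + w)^T decreases in
      -- expectation by the factor b / (b + 1) in each round, where b = (2 + w)² − 2 and
      -- b + 1 = (1 + w)(3 + w).
      biased-acceptance : fromℕ (4 ℕ.+ w) ≤ fromℕ 2 * fromℕ (2 ℕ.+ w) * heads → ∀ T a →
        fromℕ (((2 ℕ.+ w) ℕ.* ((1 ℕ.+ w) ℕ.* (3 ℕ.+ w))) ℕ.^ T) * fromℕ a * Pr O true (bet w C T a)
          ≤ fromℕ (C ℕ.* (2 ℕ.+ w ℕ.* (4 ℕ.+ w)) ℕ.^ T)
      -- Markov's inequality for the inverse capital: a times the indicator of a < C is at most C.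
      biased-acceptance bias zero a with a ℕ.<ᵇ C | ℕ.<ᵇ-reflects-< a C
      ... | true  | ofʸ a<C = begin
        fromℕ 1 * fromℕ a * 1#   ≈⟨ trans (*-identityʳ _) (trans (*-congʳ (+-identityʳ 1#)) (*-identityˡ _)) ⟩
        fromℕ a                  ≤⟨ fromℕ-mono-≤ (ℕ.<⇒≤ a<C) ⟩
        fromℕ C                  ≡⟨ ≡.cong fromℕ (ℕ.*-identityʳ C) ⟨
        fromℕ (C ℕ.* 1)          ∎
      ... | false | ofⁿ a≮C = ≤-trans (≤-reflexive (zeroʳ _)) (0≤fromℕ (C ℕ.* 1))
      biased-acceptance bias (suc T) a = begin
        fromℕ (B ℕ.* B ℕ.^ T) * A * Pr O true (bet w C (suc T) a)
          ≈⟨ *-cong (*-congʳ (trans (fromℕ-* B (B ℕ.^ T)) (*-congʳ (trans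
               (fromℕ-* (2 ℕ.+ w) ((1 ℕ.+ w) ℕ.* (3 ℕ.+ w))) (*-congˡ (fromℕ-* (1 ℕ.+ w) (3 ℕ.+ w))))))) (Pr-round true next) ⟩
        fromℕ (2 ℕ.+ w) * (fromℕ (1 ℕ.+ w) * fromℕ (3 ℕ.+ w)) * X * A * (Q + (P - Q) * heads)
          ≈⟨ solve 8 (λ n n⁻ n⁺ x a p q h →
               n :* (n⁻ :* n⁺) :* x :* a :* (q :+ (p :- q) :* h)
                 := n :* n⁻ :* h :* (x :* (a :* n⁺) :* p) :+ n :* n⁺ :* (con (pos 1) :- h) :* (x :* (a :* n⁻) :* q))
               refl (fromℕ (2 ℕ.+ w)) (fromℕ (1 ℕ.+ w)) (fromℕ (3 ℕ.+ w)) X A P Q heads ⟩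
        fromℕ (2 ℕ.+ w) * fromℕ (1 ℕ.+ w) * heads * (X * (A * fromℕ (3 ℕ.+ w)) * P)
          + fromℕ (2 ℕ.+ w) * fromℕ (3 ℕ.+ w) * (1# - heads) * (X * (A * fromℕ (1 ℕ.+ w)) * Q)
          ≤⟨ +-mono-≤
               (*-monoˡ-≤ (0≤-* (0≤-* (0≤fromℕ (2 ℕ.+ w)) (0≤fromℕ (1 ℕ.+ w))) 0≤heads) (ih true))
               (*-monoˡ-≤ (0≤-* (0≤-* (0≤fromℕ (2 ℕ.+ w)) (0≤fromℕ (3 ℕ.+ w))) (x≤y⇒0≤y-x heads≤1)) (ih false)) ⟩
        -- With N = 2 + w the coefficient of Y is N (N + 1) - 2 N q, which decreases in q. The bias
        -- hypothesis 2 N q ≥ N + 2 leaves N² - 2 = b.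
        fromℕ (2 ℕ.+ w) * fromℕ (1 ℕ.+ w) * heads * Y + fromℕ (2 ℕ.+ w) * fromℕ (3 ℕ.+ w) * (1# - heads) * Y
          ≈⟨ solve 3 (λ w h y → let n = con (pos 1) :+ (con (pos 1) :+ w) in
               n :* (con (pos 1) :+ w) :* h :* y :+ n :* (con (pos 1) :+ n) :* (con (pos 1) :- h) :* y
                 := y :* (n :* (con (pos 1) :+ n)) :- y :* (con (pos 2) :* n :* h))
               refl (fromℕ w) heads Y ⟩
        Y * (fromℕ (2 ℕ.+ w) * fromℕ (3 ℕ.+ w)) - Y * (fromℕ 2 * fromℕ (2 ℕ.+ w) * heads)
          ≤⟨ 0≤y-x⇒x≤y (≤-trans (x≤y⇒0≤y-x (*-monoˡ-≤ (0≤fromℕ (C ℕ.* b ℕ.^ T)) bias))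
               (≤-reflexive (solve 3 (λ a b c → b :- a := c :- a :- (c :- b)) refl _ _ (Y * (fromℕ (2 ℕ.+ w) * fromℕ (3 ℕ.+ w)))))) ⟩
        Y * (fromℕ (2 ℕ.+ w) * fromℕ (3 ℕ.+ w)) - Y * fromℕ (4 ℕ.+ w)
          ≈⟨ solve 2 (λ w y → let n = con (pos 1) :+ (con (pos 1) :+ w) in
               y :* (n :* (con (pos 1) :+ n)) :- y :* (con (pos 1) :+ (con (pos 1) :+ n))
                 := (con (pos 1) :+ (con (pos 1) :+ w :* (con (pos 1) :+ (con (pos 1) :+ n)))) :* y)
               refl (fromℕ w) Y ⟩
        (1# + (1# + fromℕ w * fromℕ (4 ℕ.+ w))) * Y
          ≈⟨ *-congʳ (+-congˡ (+-congˡ (fromℕ-* w (4 ℕ.+ w)))) ⟨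
        fromℕ b * Y
          ≈⟨ fromℕ-* b (C ℕ.* b ℕ.^ T) ⟨
        fromℕ (b ℕ.* (C ℕ.* b ℕ.^ T))
          ≡⟨ ≡.cong fromℕ (x∙yz≈y∙xz b C (b ℕ.^ T)) ⟩
        fromℕ (C ℕ.* b ℕ.^ suc T) ∎
        where
        B = (2 ℕ.+ w) ℕ.* ((1 ℕ.+ w) ℕ.* (3 ℕ.+ w))
        b = 2 ℕ.+ w ℕ.* (4 ℕ.+ w)
        next : Bool → Algorithm (suc n) (T ℕ.* 2)
        next o = bet w C T (a ℕ.* factor w o)
        A = fromℕ a
        X = fromℕ (B ℕ.^ T)
        Y = fromℕ (C ℕ.* b ℕ.^ T)
        P = Pr O true (next true)
        Q = Pr O true (next false)
        ih : ∀ o → X * (A * fromℕ (factor w o)) * Pr O true (next o) ≤ Y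
        ih o = ≤-trans (≤-reflexive (*-congʳ (*-congˡ (sym (fromℕ-* a (factor w o))))))
          (biased-acceptance bias T (a ℕ.* factor w o))

  -- Parameters and error probabilities.

  small-error : ∀ L {δ P Q} (0<δ : 0# < δ) → recip δ 0<δ < fromℕ (2 ℕ.^ L) →
    fromℕ (2 ℕ.^ L) * P ≤ 1# → P + Q ≈ 1# → 1# - δ ≤ Q
  small-error L {δ} {P} {Q} 0<δ 1/δ<2^L 2^LP≤1 P+Q≈1 = begin
    1# - δ       ≈⟨ +-congʳ P+Q≈1 ⟨
    P + Q - δ    ≤⟨ 0≤y-x⇒x≤y (≤-trans (x≤y⇒0≤y-x P≤δ)
                      (≤-reflexive (solve 3 (λ d p q → d :- p := q :- (p :+ q :- d)) refl δ P Q))) ⟩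
    Q            ∎
    where
    open ≤-Reasoning
    P≤δ : P ≤ δ
    P≤δ = *-cancelˡ-≤ (0<fromℕ (2 ℕ.^ L) {{ℕ.m^n≢0 2 L}}) (begin
      fromℕ (2 ℕ.^ L) * P    ≤⟨ 2^LP≤1 ⟩
      1#                     ≈⟨ *-recip δ 0<δ ⟨
      δ * recip δ 0<δ        ≤⟨ *-monoˡ-≤ (<⇒≤ 0<δ) (<⇒≤ 1/δ<2^L) ⟩
      δ * fromℕ (2 ℕ.^ L)    ≈⟨ *-comm _ _ ⟩
      fromℕ (2 ℕ.^ L) * δ    ∎)

  module _ ε (0<ε : 0# < ε) δ (0<δ : 0# < δ) where
    open ≤-Reasoning

    1/ε = recip ε 0<ε
    1/δ = recip δ 0<δ

    private
      inverse-ceiling = ceiling 1/ε (0≤recip ε 0<ε)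

    -- As m exceeds 1/ε, w = 2 m² gives w ε² ≥ 2, and N = 2 + w inherits this. The integer capital
    -- after all rounds is W N^rounds, so W < 2^L becomes a comparison with `threshold`.
    m w L b rounds threshold queries : ℕ
    m         = proj₁ inverse-ceiling
    w         = 2 ℕ.* (m ℕ.* m)
    L         = proj₁ (log₂-ceiling 1/δ)
    b         = 2 ℕ.+ w ℕ.* (4 ℕ.+ w)
    -- Since (1 + 1/b)^b ≥ 2, each block of b rounds at least halves the mean of 1/W in the far
    -- case; 2L blocks give a factor 4^L.
    rounds    = b ℕ.* (2 ℕ.* L)
    threshold = 2 ℕ.^ L ℕ.* (2 ℕ.+ w) ℕ.^ rounds
    queries   = rounds ℕ.* 2

    tester : ∀ n .{{_ : NonZero n}} → Algorithm n queries
    tester (suc n) = bet w threshold rounds 1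

    1/δ<2^L : 1/δ < fromℕ (2 ℕ.^ L)
    1/δ<2^L = proj₁ (proj₂ (log₂-ceiling 1/δ))

    m≤1/ε+2 : fromℕ m ≤ 1/ε + fromℕ 2
    m≤1/ε+2 = proj₂ (proj₂ inverse-ceiling)

    2≤wε² : fromℕ 2 ≤ fromℕ w * (ε * ε)
    2≤wε² = begin
      fromℕ 2
        ≈⟨ solve 0 (con (pos 2) := con (pos 2) :* (con (pos 1) :* con (pos 1))) refl ⟩
      fromℕ 2 * (1# * 1#)
        ≤⟨ *-monoˡ-≤ (0≤fromℕ 2) (*-mono-≤ (<⇒≤ 0<1) (<⇒≤ 0<1) 1≤εm 1≤εm) ⟩
      fromℕ 2 * (ε * fromℕ m * (ε * fromℕ m))
        ≈⟨ solve 2 (λ e m → con (pos 2) :* (e :* m :* (e :* m)) := con (pos 2) :* (m :* m) :* (e :* e)) refl ε (fromℕ m) ⟩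
      fromℕ 2 * (fromℕ m * fromℕ m) * (ε * ε)
        ≈⟨ *-congʳ (trans (fromℕ-* 2 (m ℕ.* m)) (*-congˡ (fromℕ-* m m))) ⟨
      fromℕ w * (ε * ε) ∎
      where
      1≤εm : 1# ≤ ε * fromℕ m
      1≤εm = ≤-trans (≤-reflexive (sym (*-recip ε 0<ε)))
        (*-monoˡ-≤ (<⇒≤ 0<ε) (<⇒≤ (proj₁ (proj₂ inverse-ceiling))))

    module _ {n} {μ : Distribution (suc n)} (O : ConditionalOracle μ) where

      uniform-bias : IsUniform (suc n) μ →
        fromℕ (2 ℕ.^ L) * Pr O false (tester (suc n)) ≤ 1#
      uniform-bias μ≈U = *-cancelˡ-≤ (0<fromℕ N^T {{ℕ.m^n≢0 (2 ℕ.+ w) rounds}}) (begin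
        fromℕ N^T * (fromℕ (2 ℕ.^ L) * P)
          ≈⟨ solve 3 (λ a b p → a :* (b :* p) := b :* a :* p) refl (fromℕ N^T) (fromℕ (2 ℕ.^ L)) P ⟩
        fromℕ (2 ℕ.^ L) * fromℕ N^T * P
          ≈⟨ *-congʳ (fromℕ-* (2 ℕ.^ L) N^T) ⟨
        fromℕ threshold * P
          ≤⟨ fair-rejection O w threshold (heads-uniform O μ≈U) rounds 1 ⟩
        fromℕ (1 ℕ.* N^T)
          ≡⟨ ≡.cong fromℕ (ℕ.*-identityˡ N^T) ⟩
        fromℕ N^T
          ≈⟨ *-identityʳ _ ⟨
        fromℕ N^T * 1# ∎)
        where
        N^T = (2 ℕ.+ w) ℕ.^ rounds
        P = Pr O false (tester (suc n))

      -- Of the factor 4^L gained by the rounds, one 2^L pays for the threshold in Markov's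
      -- inequality and the other is the error bound.
      far-bias : Far ε (IsUniform (suc n)) μ →
        fromℕ (2 ℕ.^ L) * Pr O true (tester (suc n)) ≤ 1#
      far-bias far = *-cancelˡ-≤ (0<fromℕ K {{K≢0}}) (begin
        fromℕ K * (fromℕ (2 ℕ.^ L) * P)
          ≈⟨ trans (sym (*-assoc _ _ _)) (*-congʳ (sym (fromℕ-* K (2 ℕ.^ L)))) ⟩
        fromℕ (K ℕ.* 2 ℕ.^ L) * P
          ≈⟨ *-comm _ _ ⟩
        P * fromℕ (K ℕ.* 2 ℕ.^ L)
          ≤⟨ *-monoˡ-≤ (0≤Pr O true (tester (suc n))) (fromℕ-mono-≤ (ℕ.≤-trans (ℕ.≤-reflexive K*2^L) (growth w L))) ⟩
        P * fromℕ (B ℕ.^ rounds)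
          ≈⟨ solve 2 (λ p x → p :* x := x :* con (pos 1) :* p) refl P (fromℕ (B ℕ.^ rounds)) ⟩
        fromℕ (B ℕ.^ rounds) * 1# * P
          ≈⟨ *-congʳ (*-congˡ (+-identityʳ 1#)) ⟨
        fromℕ (B ℕ.^ rounds) * fromℕ 1 * P
          ≤⟨ biased-acceptance O w threshold bias rounds 1 ⟩
        fromℕ K
          ≈⟨ *-identityʳ _ ⟨
        fromℕ K * 1# ∎)
        where
        P = Pr O true (tester (suc n))
        B = (2 ℕ.+ w) ℕ.* ((1 ℕ.+ w) ℕ.* (3 ℕ.+ w))
        K = threshold ℕ.* b ℕ.^ rounds
        K≢0 : NonZero K
        K≢0 = ℕ.m*n≢0 threshold (b ℕ.^ rounds)
          {{ℕ.m*n≢0 (2 ℕ.^ L) _ {{ℕ.m^n≢0 2 L}} {{ℕ.m^n≢0 (2 ℕ.+ w) rounds}}}} {{ℕ.m^n≢0 b rounds}}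
        K*2^L : K ℕ.* 2 ℕ.^ L ≡ (2 ℕ.+ w) ℕ.^ rounds ℕ.* b ℕ.^ rounds ℕ.* (2 ℕ.^ L ℕ.* 2 ℕ.^ L)
        K*2^L = capital-regroup ((2 ℕ.+ w) ℕ.^ rounds) (b ℕ.^ rounds) (2 ℕ.^ L)
        -- Multiplied by N = 2 + w, the bound 2q ≥ 1 + ε² reads 2 N q ≥ N + N ε², and N ε² ≥ 2.
        bias : fromℕ (4 ℕ.+ w) ≤ fromℕ 2 * fromℕ (2 ℕ.+ w) * heads O
        bias = begin
          fromℕ (4 ℕ.+ w)
            ≈⟨ fromℕ-+ 2 (2 ℕ.+ w) ⟩
          fromℕ 2 + fromℕ (2 ℕ.+ w)
            ≤⟨ +-monoˡ-≤ (fromℕ (2 ℕ.+ w)) (≤-trans 2≤wε² (≤-trans (≤-reflexive (*-comm _ _))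
                 (≤-trans (*-monoˡ-≤ (0≤x² ε) (fromℕ-mono-≤ (ℕ.m≤n+m w 2))) (≤-reflexive (*-comm _ _))))) ⟩
          fromℕ (2 ℕ.+ w) * (ε * ε) + fromℕ (2 ℕ.+ w)
            ≈⟨ solve 2 (λ n e → n :* e :+ n := n :* (con (pos 1) :+ e)) refl (fromℕ (2 ℕ.+ w)) (ε * ε) ⟩
          fromℕ (2 ℕ.+ w) * (1# + ε * ε)
            ≤⟨ *-monoˡ-≤ (0≤fromℕ (2 ℕ.+ w)) (heads-far O (<⇒≤ 0<ε) far) ⟩
          fromℕ (2 ℕ.+ w) * (fromℕ 2 * heads O)
            ≈⟨ solve 2 (λ n q → n :* (con (pos 2) :* q) := con (pos 2) :* n :* q) refl (fromℕ (2 ℕ.+ w)) (heads O) ⟩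
          fromℕ 2 * fromℕ (2 ℕ.+ w) * heads O ∎

    accepts-uniform : ∀ n .{{_ : NonZero n}} (μ : Distribution n) (O : ConditionalOracle μ) →
      IsUniform n μ → 1# - δ ≤ Pr O true (tester n)
    accepts-uniform (suc n) μ O μ≈U = small-error L 0<δ 1/δ<2^L (uniform-bias O μ≈U)
      (trans (+-comm _ _) (Pr-total O (tester (suc n))))

    rejects-far : ∀ n .{{_ : NonZero n}} (μ : Distribution n) (O : ConditionalOracle μ) →
      Far ε (IsUniform n) μ → 1# - δ ≤ Pr O false (tester n)
    rejects-far (suc n) μ O far = small-error L 0<δ 1/δ<2^L (far-bias O far) (Pr-total O (tester (suc n)))

    -- The number of queries as a polynomial.

    b-bound : fromℕ b ≤ fromℕ 2 + fromℕ 2 * ((1/ε + fromℕ 2) * (1/ε + fromℕ 2))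
                * (fromℕ 4 + fromℕ 2 * ((1/ε + fromℕ 2) * (1/ε + fromℕ 2)))
    b-bound = begin
      fromℕ b                                  ≈⟨ fromℕ-+ 2 (w ℕ.* (4 ℕ.+ w)) ⟩
      fromℕ 2 + fromℕ (w ℕ.* (4 ℕ.+ w))        ≈⟨ +-congˡ (fromℕ-* w (4 ℕ.+ w)) ⟩
      fromℕ 2 + fromℕ w * fromℕ (4 ℕ.+ w)      ≈⟨ +-congˡ (*-congˡ (fromℕ-+ 4 w)) ⟩
      fromℕ 2 + fromℕ w * (fromℕ 4 + fromℕ w)
        ≤⟨ +-mono-≤ ≤-refl (*-mono-≤ (0≤fromℕ w) (≤-trans (0≤fromℕ (4 ℕ.+ w)) (≤-reflexive (fromℕ-+ 4 w)))
             w≤ (+-mono-≤ ≤-refl w≤)) ⟩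
      fromℕ 2 + fromℕ 2 * (z * z) * (fromℕ 4 + fromℕ 2 * (z * z)) ∎
      where
      z = 1/ε + fromℕ 2
      w≤ : fromℕ w ≤ fromℕ 2 * (z * z)
      w≤ = ≤-trans (≤-reflexive (trans (fromℕ-* 2 (m ℕ.* m)) (*-congˡ (fromℕ-* m m))))
        (*-monoˡ-≤ (0≤fromℕ 2) (*-mono-≤ (0≤fromℕ m) (0≤fromℕ m) m≤1/ε+2 m≤1/ε+2))

    -- The estimate is made in |ℓ|, which is no polynomial in ℓ; bounding it by an even polynomial
    -- removes the absolute value.
    L-bound : ∀ {ℓ} → IsLog 1/δ ℓ → fromℕ L ≤ fromℕ 36 + fromℕ 8 * (ℓ * ℓ)
    L-bound {ℓ} log = begin
      fromℕ L
        ≤⟨ fromℕ-mono-≤ (L≤ L (proj₂ (proj₂ (log₂-ceiling 1/δ)))) ⟩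
      fromℕ (4 ℕ.+ 2 ℕ.* k ℕ.* (2 ℕ.* k))
        ≈⟨ trans (fromℕ-+ 4 (2 ℕ.* k ℕ.* (2 ℕ.* k))) (+-congˡ (trans (fromℕ-* (2 ℕ.* k) (2 ℕ.* k)) (*-cong (fromℕ-* 2 k) (fromℕ-* 2 k)))) ⟩
      fromℕ 4 + fromℕ 2 * fromℕ k * (fromℕ 2 * fromℕ k)
        ≤⟨ +-mono-≤ ≤-refl (*-mono-≤ 0≤2k 0≤2k 2k≤ 2k≤) ⟩
      fromℕ 4 + fromℕ 2 * (a + fromℕ 2) * (fromℕ 2 * (a + fromℕ 2))
        -- The linear term in 4 + 4 (a + 2)² is absorbed: 36 + 8 a² exceeds it by 4 (a - 2)².
        ≤⟨ 0≤y-x⇒x≤y (≤-trans (0≤-* (0≤fromℕ 4) (0≤x² (a - fromℕ 2))) (≤-reflexive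
             (solve 1 (λ a → con (pos 4) :* ((a :- con (pos 2)) :* (a :- con (pos 2)))
               := con (pos 36) :+ con (pos 8) :* (a :* a)
                  :- (con (pos 4) :+ con (pos 2) :* (a :+ con (pos 2)) :* (con (pos 2) :* (a :+ con (pos 2))))) refl a))) ⟩
      fromℕ 36 + fromℕ 8 * (a * a)
        ≤⟨ +-mono-≤ ≤-refl (*-monoˡ-≤ (0≤fromℕ 8) (∣x∣²≤x² ℓ)) ⟩
      fromℕ 36 + fromℕ 8 * (ℓ * ℓ) ∎
      where
      a = ∣ ℓ ∣ᴿ
      k-ceiling = ceiling a (0≤∣x∣ ℓ)
      k = proj₁ k-ceiling
      a≤k : a ≤ fromℕ k
      a≤k = <⇒≤ (proj₁ (proj₂ k-ceiling))
      0≤2k : 0# ≤ fromℕ 2 * fromℕ k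
      0≤2k = 0≤-* (0≤fromℕ 2) (0≤fromℕ k)
      2k≤ : fromℕ 2 * fromℕ k ≤ fromℕ 2 * (a + fromℕ 2)
      2k≤ = *-monoˡ-≤ (0≤fromℕ 2) (proj₂ (proj₂ k-ceiling))
      -- Only 2^(L - 2) is known to lie below 1/δ, so 2 is added to the bound 2 + (2k)² on that
      -- exponent.
      L≤ : ∀ L → (∀ j → L ≡ suc (suc j) → fromℕ (2 ℕ.^ j) < 1/δ) → L ℕ.≤ 4 ℕ.+ 2 ℕ.* k ℕ.* (2 ℕ.* k)
      L≤ zero          low = ℕ.z≤n
      L≤ (suc zero)    low = ℕ.s≤s ℕ.z≤n
      L≤ (suc (suc j)) low = ℕ.s≤s (ℕ.s≤s (IsLog-lower-bound log k (≤-trans (x≤∣x∣ ℓ) a≤k)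
        (≤-trans (-x≤∣x∣ ℓ) a≤k) j (low j ≡.refl)))

  uniformityTester : Tester IsUniform
  uniformityTester = record
    { complexity = λ ε 0<ε δ 0<δ _ → queries ε 0<ε δ 0<δ
    ; algorithm  = tester
    ; accepts    = accepts-uniform
    ; rejects    = rejects-far
    }

  -- The number of queries is 4 b L, with `b` bounded through 1/ε alone and `L` through the
  -- logarithm alone. One `bound` serves both variables, so the shorter coefficient list is padded
  -- with zeros.
  separable : ∀ {k} → (Fin k → Carrier) → (Fin k → Carrier) → Polynomial₂
  separable {k} α β = record { bound = k ; coeff = λ i j → α i * β j }

  eval-separable : ∀ {k} (α β : Fin k → Carrier) x y → Polynomial₂.eval (separable α β) x y ≈
    (∑[ i < k ] (α i * x ^ toℕ i)) * (∑[ j < k ] (β j * y ^ toℕ j))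
  eval-separable {k} α β x y = begin-equality
    ∑[ i < k ] ∑[ j < k ] (α i * β j * x ^ toℕ i * y ^ toℕ j)
      ≈⟨ sum-cong-≋ (λ i → trans
           (sum-cong-≋ λ j → solve 4 (λ a b c d → a :* b :* c :* d := a :* c :* (b :* d)) refl
             (α i) (β j) (x ^ toℕ i) (y ^ toℕ j))
           (sym (*-distribˡ-sum (α i * x ^ toℕ i) (λ j → β j * y ^ toℕ j)))) ⟩
    ∑[ i < k ] (α i * x ^ toℕ i * (∑[ j < k ] (β j * y ^ toℕ j)))
      ≈⟨ *-distribʳ-sum (∑[ j < k ] (β j * y ^ toℕ j)) (λ i → α i * x ^ toℕ i) ⟨
    (∑[ i < k ] (α i * x ^ toℕ i)) * (∑[ j < k ] (β j * y ^ toℕ j)) ∎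
    where open ≤-Reasoning

  -- 2 + 2 (x + 2)² (4 + 2 (x + 2)²)
  ε-coefficients : Fin 5 → Carrier
  ε-coefficients = fromℕ ∘ lookup (98 ∷ 160 ∷ 104 ∷ 32 ∷ 4 ∷ [])

  -- 4 (36 + 8 y²)
  δ-coefficients : Fin 5 → Carrier
  δ-coefficients = fromℕ ∘ lookup (144 ∷ 0 ∷ 32 ∷ 0 ∷ 0 ∷ [])

  queries-bound : ∀ ε (0<ε : 0# < ε) δ (0<δ : 0# < δ) {ℓ} → IsLog (recip δ 0<δ) ℓ →
    fromℕ (queries ε 0<ε δ 0<δ) ≤ Polynomial₂.eval (separable ε-coefficients δ-coefficients) (recip ε 0<ε) ℓ
  queries-bound ε 0<ε δ 0<δ {ℓ} log = begin
    fromℕ (B ℕ.* (2 ℕ.* K) ℕ.* 2)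
      ≈⟨ trans (fromℕ-* (B ℕ.* (2 ℕ.* K)) 2) (*-congʳ (trans (fromℕ-* B (2 ℕ.* K)) (*-congˡ (fromℕ-* 2 K)))) ⟩
    fromℕ B * (fromℕ 2 * fromℕ K) * fromℕ 2
      ≈⟨ solve 2 (λ b k → b :* (con (pos 2) :* k) :* con (pos 2) := b :* (con (pos 4) :* k)) refl (fromℕ B) (fromℕ K) ⟩
    fromℕ B * (fromℕ 4 * fromℕ K)
      ≤⟨ *-mono-≤ (0≤fromℕ B) (0≤-* (0≤fromℕ 4) (0≤fromℕ K))
           (b-bound ε 0<ε δ 0<δ) (*-monoˡ-≤ (0≤fromℕ 4) (L-bound ε 0<ε δ 0<δ log)) ⟩
    (fromℕ 2 + fromℕ 2 * (z * z) * (fromℕ 4 + fromℕ 2 * (z * z))) * (fromℕ 4 * (fromℕ 36 + fromℕ 8 * (ℓ * ℓ)))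
      ≈⟨ *-cong (expand-ε r) (expand-δ ℓ) ⟩
    (∑[ i < 5 ] (ε-coefficients i * r ^ toℕ i)) * (∑[ j < 5 ] (δ-coefficients j * ℓ ^ toℕ j))
      ≈⟨ eval-separable ε-coefficients δ-coefficients r ℓ ⟨
    Polynomial₂.eval (separable ε-coefficients δ-coefficients) r ℓ ∎
    where
    open ≤-Reasoning
    B = b ε 0<ε δ 0<δ
    K = L ε 0<ε δ 0<δ
    r = recip ε 0<ε
    z = r + fromℕ 2
    expand-ε : ∀ r → fromℕ 2 + fromℕ 2 * ((r + fromℕ 2) * (r + fromℕ 2)) * (fromℕ 4 + fromℕ 2 * ((r + fromℕ 2) * (r + fromℕ 2)))
      ≈ ∑[ i < 5 ] (ε-coefficients i * r ^ toℕ i)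
    -- The right-hand side mirrors the unfolding of `∑` and `^`, with the power 0 as a factor 1 and
    -- the empty sum as a final 0, so that it matches the goal by computation.
    expand-ε = solve 1 (λ r →
      con (pos 2) :+ con (pos 2) :* ((r :+ con (pos 2)) :* (r :+ con (pos 2)))
        :* (con (pos 4) :+ con (pos 2) :* ((r :+ con (pos 2)) :* (r :+ con (pos 2))))
      := con (pos 98) :* con (pos 1) :+ (con (pos 160) :* (r :* con (pos 1)) :+ (con (pos 104) :* (r :* (r :* con (pos 1)))
         :+ (con (pos 32) :* (r :* (r :* (r :* con (pos 1)))) :+ (con (pos 4) :* (r :* (r :* (r :* (r :* con (pos 1))))) :+ con (pos 0)))))) refl
    expand-δ : ∀ y → fromℕ 4 * (fromℕ 36 + fromℕ 8 * (y * y)) ≈ ∑[ j < 5 ] (δ-coefficients j * y ^ toℕ j)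
    expand-δ = solve 1 (λ r →
      con (pos 4) :* (con (pos 36) :+ con (pos 8) :* (r :* r))
      := con (pos 144) :* con (pos 1) :+ (con (pos 0) :* (r :* con (pos 1)) :+ (con (pos 32) :* (r :* (r :* con (pos 1)))
         :+ (con (pos 0) :* (r :* (r :* (r :* con (pos 1)))) :+ (con (pos 0) :* (r :* (r :* (r :* (r :* con (pos 1))))) :+ con (pos 0)))))) refl

theorem3p1p1 : ∀ {c ℓ₁ ℓ₂} (R : RealNumbers c ℓ₁ ℓ₂) →
    let open RealNumbers R
        open Testing R
    in
    Σ[ p ∈ Polynomial₂ ] Σ[ T ∈ Tester IsUniform ]
      (∀ ε (0<ε : 0# < ε) → ε < 1# →
       ∀ δ (0<δ : 0# < δ) → δ < 1# →
       ∀ (n : ℕ) .{{_ : NonZero n}} →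
       ∀ logδ⁻¹ → IsLog (recip δ 0<δ) logδ⁻¹ →
       fromℕ (Tester.complexity T ε 0<ε δ 0<δ n)
         ≤ Polynomial₂.eval p (recip ε 0<ε) logδ⁻¹)
theorem3p1p1 R =
    separable ε-coefficients δ-coefficients , uniformityTester
  , λ ε 0<ε _ δ 0<δ _ n ℓ log → queries-bound ε 0<ε δ 0<δ log
  where open UniformityTester R
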